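{- Let $m\in\mathbb{N}$ and $A\subseteq\mathbb{N}^m$. The following two statements are equivalent. (1) There exist functions $\alpha_1,\ldots,\alpha_m:\mathcal{P}_f(\mathbb{N}^{\mathbb{N}})\to\mathbb{N}$ and $H_1,\ldots,H_m:\mathcal{P}_f(\mathbb{N}^{\mathbb{N}})\to\mathcal{P}_f(\mathbb{N})$ such that (a) if $F,G\in\mathcal{P}_f(\mathbb{N}^{\mathbb{N}})$ and $F\subsetneq G$, then for every $i\in\{1,\ldots,m\}$, $\max H_i(F)<\min H_i(G)$; and (b) whenever $n\in\mathbb{N}$ with $n\ge m$, $G_1\subsetneq G_2\subsetneq\cdots\subsetneq G_n$ in $\mathcal{P}_f(\mathbb{N}^{\mathbb{N}})$, $\beta_1<\beta_2<\cdots<\beta_m$ in $\mathcal{P}_f(\mathbb{N})$ with $\max\beta_m\le n$, and $f_i\in G_i$ for every $i\in\{1,\ldots,n\}$, one has $$\left(\sum_{i\in\beta_1}\Bigl(\alpha_1(G_i)+\sum_{t\in H_1(G_i)}f_i(t)\Bigr),\ldots,\sum_{i\in\beta_m}\Bigl(\alpha_m(G_i)+\sum_{t\in H_m(G_i)}f_i(t)\Bigr)\right)\in A.$$ (2) There exist idempotents $p_1,\ldots,p_m$ in $(\mathcal{J},+)$ such that $A\in\bigotimes_{i=1}^m p_i$.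
   Context: $\mathbb{N}$ is the set of positive integers; $\mathcal{P}_f(X)$ is the set of nonempty finite subsets of $X$; $\mathbb{N}^{\mathbb{N}}$ is the set of all functions $\mathbb{N}\to\mathbb{N}$. For $\beta,\gamma\in\mathcal{P}_f(\mathbb{N})$, $\beta<\gamma$ means $\max\beta<\min\gamma$. $\beta\mathbb{N}$ is the set of ultrafilters on $\mathbb{N}$, with the operation: $A\in p+q$ iff $\{x\in\mathbb{N}:-x+A\in q\}\in p$, where $-x+A=\{y\in\mathbb{N}:x+y\in A\}$. An ultrafilter $p$ is idempotent if $p+p=p$. A set $A\subseteq\mathbb{N}$ is a $J$-set if for every $F\in\mathcal{P}_f(\mathbb{N}^{\mathbb{N}})$ there exist $a\in\mathbb{N}$ and $\beta\in\mathcal{P}_f(\mathbb{N})$ such that $a+\sum_{t\in\beta}f(t)\in A$ for all $f\in F$. $\mathcal{J}=\{p\in\beta\mathbb{N}:\text{every }A\in p\text{ is a }J\text{ -set}\}$; it is a two-sided ideal of $(\beta\mathbb{N},+)$. Tensor products: for ultrafilters $p_1,\ldots,p_k$ on $\mathbb{N}$, $\bigotimes_{i=1}^k p_i$ is the ultrafilter on $\mathbb{N}^k$ defined recursively by $\bigotimes_{i=1}^1p_i=p_1$, and, for $A\subseteq\mathbb{N}^{k+1}$, $A\in\bigotimes_{i=1}^{k+1}p_i$ iff $\{(x_1,\ldots,x_k)\in\mathbb{N}^k:\{x_{k+1}\in\mathbb{N}:(x_1,\ldots,x_{k+1})\in A\}\in p_{k+1}\}\in\bigotimes_{i=1}^kp_i$.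 -}

module Defs where

open import Data.Bool using (Bool; true; false; T; not; _∧_)
open import Data.Empty using (⊥-elim)
open import Data.Fin using (Fin; inject₁; fromℕ)
import Data.List.Membership.Propositional as List
open import Data.List.NonEmpty as List⁺ using (List⁺; toList; foldr₁)
import Data.List.Relation.Binary.Subset.Propositional as List
open import Data.List.Relation.Unary.Unique.Propositional using (Unique)
open import Data.Nat using (ℕ; zero; suc; _+_; _⊔_; _⊓_; _<_; NonZero)
open import Data.Product using (∃-syntax; _×_; _,_)
open import Data.Sum using (_⊎_; inj₁; inj₂)
open import Data.Unit using (tt)
open import Data.Vec as Vec using (Vec; _∷ʳ_)
open import Function using (_∘_; id; _⇔_)
open import Level using (0ℓ)
open import Relation.Binary.Bundles using (Setoid)
open import Relation.Nullary using (¬_)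

-- The positive integers.  The proof of positivity is irrelevant, so elements
-- with equal values are equal.
record ℕ⁺ : Set where
  constructor pos
  field
    value       : ℕ
    .{{nonZero}} : NonZero value

open ℕ⁺ public using (value)

+-nonZeroˡ : ∀ m n .{{_ : NonZero m}} → NonZero (m + n)
+-nonZeroˡ (suc m) n = _

infixl 6 _+⁺_
_+⁺_ : ℕ⁺ → ℕ⁺ → ℕ⁺
pos m +⁺ pos n = pos (m + n) {{+-nonZeroˡ m n}}

-- Subsets are characteristic functions.  In the presence of excluded middle
-- (see the hypotheses of the theorem) every predicate P : X → Set arises from
-- one, so this is the full power set; unlike X → Set, it stays in Set.
Subset : Set → Set
Subset X = X → Bool

infix 4 _∈_
_∈_ : ∀ {X} → X → Subset X → Set
x ∈ A = T (A x)

-- 𝒫f X, the nonempty finite subsets of X, presented by nonempty lists without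
-- repetition.  Two of them are the same set, F ≈ G, when they have the same
-- elements, so a function on the set of nonempty finite subsets is a setoid
-- function on 𝒫f-setoid X.  For X = ℕ⁺ → ℕ⁺, elements are compared by _≡_, which
-- is pointwise equality under the function extensionality the theorem assumes.
record 𝒫f (X : Set) : Set where
  constructor mk𝒫f
  field
    elements : List⁺ X
    unique   : Unique (toList elements)

open 𝒫f public

infix 4 _∈f_ _⊆f_ _≈_ _⊊_
_∈f_ : ∀ {X} → X → 𝒫f X → Set
x ∈f F = x List.∈ toList (elements F)

_⊆f_ _≈_ _⊊_ : ∀ {X} → 𝒫f X → 𝒫f X → Set
F ⊆f G = toList (elements F) List.⊆ toList (elements G)
F ≈ G  = F ⊆f G × G ⊆f F
F ⊊ G  = F ⊆f G × ¬ (F ≈ G)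

𝒫f-setoid : Set → Setoid 0ℓ 0ℓ
𝒫f-setoid X = record
  { Carrier       = 𝒫f X
  ; _≈_           = _≈_
  ; isEquivalence = record
    { refl  = id , id
    ; sym   = λ (p , q) → q , p
    ; trans = λ (p , q) (r , s) → (λ x → r (p x)) , (λ x → q (s x))
    }
  }

max min : 𝒫f ℕ⁺ → ℕ
max β = foldr₁ _⊔_ (List⁺.map value (elements β))
min β = foldr₁ _⊓_ (List⁺.map value (elements β))

infix 4 _<f_
_<f_ : 𝒫f ℕ⁺ → 𝒫f ℕ⁺ → Set
β <f γ = max β < min γ

-- Well defined on sets: uniqueness of the list rules out repeated summands.
∑ : ∀ {X} → 𝒫f X → (X → ℕ⁺) → ℕ⁺
∑ β f = foldr₁ _+⁺_ (List⁺.map f (elements β))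

record Ultrafilter (X : Set) : Set where
  field
    sets   : Subset (Subset X)
    full   : (λ _ → true) ∈ sets
    proper : ¬ ((λ _ → false) ∈ sets)
    upward : ∀ A B → A ∈ sets → (∀ x → x ∈ A → x ∈ B) → B ∈ sets
    inter  : ∀ A B → A ∈ sets → B ∈ sets → (λ x → A x ∧ B x) ∈ sets
    ultra  : ∀ A → A ∈ sets ⊎ (λ x → not (A x)) ∈ sets

open Ultrafilter public using (sets)

private
  T-∧⁻ : ∀ a b → T (a ∧ b) → T a × T b
  T-∧⁻ true true _ = tt , tt

  T-∧⁺ : ∀ a b → T a → T b → T (a ∧ b)
  T-∧⁺ true true _ _ = tt

  T-not⁺ : ∀ a → ¬ T a → T (not a)
  T-not⁺ true  h = h tt
  T-not⁺ false h = tt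

  T-not⁻ : ∀ a → T (not a) → ¬ T a
  T-not⁻ false _ ()

-- The iterated limit of p and q along c : X → Y → Z, namely
-- { A ⊆ Z : { x : { y : c x y ∈ A } ∈ q } ∈ p }.
-- With c x y = x + y the inner set is -x+A and this is p + q; with c appending
-- a last coordinate it is the recursion step of the tensor product.
extend : ∀ {X Y Z} → (X → Y → Z) → Ultrafilter X → Ultrafilter Y → Ultrafilter Z
extend c p q = record
  { sets   = λ A → sets p (λ x → sets q (λ y → A (c x y)))
  ; full   = P.upward _ _ P.full (λ _ _ → Q.full)
  ; proper = λ h → P.proper (P.upward _ _ h (λ _ k → ⊥-elim (Q.proper k)))
  ; upward = λ A B h A⊆B → P.upward _ _ h
      (λ x k → Q.upward _ _ k (λ y → A⊆B (c x y)))
  ; inter  = λ A B h k → P.upward _ _ (P.inter _ _ h k)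
      (λ x l → let (a , b) = T-∧⁻ (sets q (λ y → A (c x y))) _ l
               in Q.inter _ _ a b)
  ; ultra  = λ A → ultra′ A (P.ultra (λ x → sets q (λ y → A (c x y))))
  }
  where
  module P = Ultrafilter p
  module Q = Ultrafilter q

  fromSum : ∀ {B C : Set} → B ⊎ C → ¬ B → C
  fromSum (inj₁ b) h = ⊥-elim (h b)
  fromSum (inj₂ c) h = c

  S : Subset _ → Subset _
  S A x = sets q (λ y → A (c x y))

  ultra′ : ∀ A → S A ∈ sets p ⊎ (λ x → not (S A x)) ∈ sets p →
           S A ∈ sets p ⊎ S (λ z → not (A z)) ∈ sets p
  ultra′ A (inj₁ h) = inj₁ h
  ultra′ A (inj₂ h) = inj₂ (P.upward _ _ h
    (λ x k → fromSum (Q.ultra (λ y → A (c x y))) (T-not⁻ (S A x) k)))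

infixl 6 _⊕_
_⊕_ : Ultrafilter ℕ⁺ → Ultrafilter ℕ⁺ → Ultrafilter ℕ⁺
_⊕_ = extend _+⁺_

Idempotent : Ultrafilter ℕ⁺ → Set
Idempotent p = ∀ A → A ∈ sets (p ⊕ p) ⇔ A ∈ sets p

IsJSet : Subset ℕ⁺ → Set
IsJSet A = ∀ (F : 𝒫f (ℕ⁺ → ℕ⁺)) →
  ∃[ a ] ∃[ β ] (∀ f → f ∈f F → (a +⁺ ∑ β f) ∈ A)

𝒥 : Ultrafilter ℕ⁺ → Set
𝒥 p = ∀ A → A ∈ sets p → IsJSet A

image : ∀ {X Y} → (X → Y) → Ultrafilter X → Ultrafilter Y
image g p = record
  { sets   = λ A → sets p (A ∘ g)
  ; full   = P.full
  ; proper = P.proper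
  ; upward = λ A B h A⊆B → P.upward _ _ h (λ x → A⊆B (g x))
  ; inter  = λ A B → P.inter _ _
  ; ultra  = λ A → P.ultra (A ∘ g)
  }
  where module P = Ultrafilter p

-- ℕ⁺ is identified with Vec ℕ⁺ 1 in the base case.
⨂ : ∀ k → (Fin (suc k) → Ultrafilter ℕ⁺) → Ultrafilter (Vec ℕ⁺ (suc k))
⨂ zero    p = image Vec.[_] (p (fromℕ 0))
⨂ (suc k) p = extend _∷ʳ_ (⨂ k (p ∘ inject₁)) (p (fromℕ (suc k)))

{-# OPTIONS --safe #-}

-- (1) ⇒ (2).  For each coordinate let T(F) be the set of all sums
-- ∑ᵢ (α(Gᵢ) + ∑_{H(Gᵢ)} fᵢ) over chains F ⊊ G₁ ⊊ ⋯ ⊊ Gₙ with fᵢ ∈ Gᵢ.  Each T(F)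
-- is a J-set, and J-sets are partition regular by the Hales–Jewett theorem, so
-- the sets A for which some T(F) ∖ A is not a J-set form a proper filter 𝓕.
-- It satisfies { x : -x + A ∈ 𝓕 } ∈ 𝓕 for A ∈ 𝓕, and Zorn's lemma applied to such
-- filters gives an idempotent p ⊇ 𝓕, as in the Ellis–Numakura lemma.  Then p lies
-- in 𝒥 and contains all T(F), and A ∈ ⨂ pᵢ follows by stacking chains.
--
-- (2) ⇒ (1).  For the first coordinate, α₁(F) and H₁(F) are chosen by recursion
-- along ⊊ so that the sums of all chains with bottom G stay in
-- R* = { x ∈ R : -x + R ∈ p₁ } for a prescribed R = R(G) ∈ p₁; at each F only
-- finitely many members of p₁ have to be met, and their intersection is a J-set.
-- The remaining coordinates follow by induction, with the requirement at F
-- consisting of the finitely many sections at the sums of chains below F.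

module Submission where

open import Defs
open import Axiom.ExcludedMiddle using (ExcludedMiddle)
open import Axiom.Extensionality.Propositional using (Extensionality)
open import Data.Bool using (true; false; T; not; _∧_)
open import Data.Bool.Properties using (T-∧)
open import Data.Empty using (⊥; ⊥-elim)
open import Data.Fin as Fin using (Fin; zero; suc; fromℕ; inject₁; punchOut; funToFin; finToFun)
open import Data.Fin.Properties using (punchOut-injective; finToFun-funToFin)
open import Data.List as List using (List; []; _∷_; map; length; allFin; concatMap; filter)
  renaming (_++_ to _++ₗ_)
open import Data.List.Membership.Propositional using (find) renaming (_∈_ to _∈ₗ_)
open import Data.List.Membership.Propositional.Properties
  using (∈-map⁺; ∈-map⁻; ∈-++⁺ˡ; ∈-++⁺ʳ; ∈-++⁻; ∈-allFin; ∈-deduplicate⁺;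
         ∈-concatMap⁺; ∈-concatMap⁻; ∈-filter⁺; ∈-filter⁻; ∈-∃++)
open import Data.List.NonEmpty as List⁺ using (List⁺; toList; foldr₁; _⁺++⁺_) renaming (_∷_ to _∷⁺_)
open import Data.List.Properties
  using (map-cong-local) renaming (map-∘ to mapₗ-∘; map-++ to mapₗ-++; length-++ to lengthₗ-++)
open import Data.List.Relation.Binary.Permutation.Propositional using (_↭_; ↭-sym; ↭⇒↭ₛ)
open import Data.List.Relation.Binary.Permutation.Propositional.Properties
  using (All-resp-↭; ↭-length) renaming (map⁺ to ↭-map⁺)
import Data.List.Relation.Binary.Permutation.Setoid.Properties as Permutation
open import Data.List.Relation.Unary.All as All using (All; []; _∷_)
import Data.List.Relation.Unary.All.Properties as All
open import Data.List.Relation.Unary.AllPairs as AllPairs using (AllPairs; []; _∷_)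
import Data.List.Relation.Unary.AllPairs.Properties as AllPairs
open import Data.List.Relation.Unary.Any as ListAny using (index) renaming (here to hereₗ; there to thereₗ)
open import Data.List.Relation.Unary.Any.Properties using (lookup-index)
open import Data.List.Relation.Unary.Sorted.TotalOrder.Properties using (Sorted⇒AllPairs)
open import Data.List.Relation.Unary.Unique.DecPropositional.Properties using (deduplicate-!)
open import Data.List.Relation.Unary.Unique.Propositional using (Unique)
import Data.List.Relation.Unary.Unique.Propositional.Properties as Unique
import Data.List.Sort as Sort
open import Data.Maybe as Maybe using (Maybe; just; nothing; fromMaybe)
open import Data.Nat
  using (ℕ; zero; suc; pred; _+_; _*_; _⊔_; _⊓_; _^_; _≤_; _<_; _≤?_; z≤n; s≤s; NonZero; >-nonZero)
open import Data.Nat.DivMod using (_%_; [m+kn]%n≡m%n; m<n⇒m%n≡m)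
open import Data.Nat.ListAction using (sum)
open import Data.Nat.ListAction.Properties using (sum-++; sum-↭)
open import Data.Nat.Properties
open import Data.Product using (∃; ∃-syntax; _×_; _,_; proj₁; proj₂)
open import Data.Sum using (_⊎_; inj₁; inj₂)
open import Data.Unit using (⊤; tt)
open import Data.Vec as Vec using (Vec; []; _∷_; _++_; _∷ʳ_; lookup; tabulate)
open import Data.Vec.Properties using (tabulate∘lookup; tabulate-cong; map-++; map-∘; map-id)
open import Data.Vec.Relation.Unary.Any using (Any; here; there)
open import Data.Vec.Relation.Unary.Any.Properties using (++⁺ˡ; ++⁺ʳ)
open import Function using (_∘_; id; mk⇔; Equivalence; _⇔_; _⟶ₛ_; _⟨$⟩_)
open import Level using (0ℓ)
open import Relation.Binary.Bundles using (DecTotalOrder)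
import Relation.Binary.Construct.Flip.EqAndOrd as Flip
import Relation.Binary.Construct.On as On
open import Relation.Nullary using (¬_; yes; no)
open import Relation.Nullary.Decidable using (⌊_⌋; toWitness; fromWitness; decidable-stable)
open import Relation.Binary.PropositionalEquality

-- A filter stands for the closed set of ultrafilters above it. Under this dictionary 𝓕 is exactly
-- the set of those p in 𝒥 that contain every T(F): the complement of a set that is not a J-set lies
-- in 𝓕, and if T(F) minus A is not a J-set, then A lies in each such p. So one idempotent above 𝓕
-- has both properties wanted from it. T(F) need not be closed under addition, but for x in T(F)
-- there is a K with x + T(K) inside T(F), which is enough for the condition on 𝓕.
--
-- In (2) ⇒ (1) the obstacle is that later coordinates have to fit whatever sums the earlier ones
-- produced, so no fixed member of pᵢ can serve as the target. The target R(G) therefore depends on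
-- the bottom G of a chain: G has finitely many proper subsets, each carrying finitely many sums.
-- For this finiteness, and because α and H have to be functions of sets, the recursion runs over
-- representative lists of sets.

-- The Hales–Jewett theorem

-- The letter nothing is the variable of a variable word.
Template : Set → ℕ → Set
Template A n = Vec (Maybe A) n

HasVariable : ∀ {A n} → Template A n → Set
HasVariable = Any (_≡ nothing)

infixl 8 _⟨_⟩
_⟨_⟩ : ∀ {A n} → Template A n → A → Vec A n
τ ⟨ a ⟩ = Vec.map (fromMaybe a) τ

-- A combinatorial subspace of dimension `m` in the words of length `n`, each variable occupying an
-- interval of its own; `fill` is its parametrization.
data Blocks (A : Set) : ℕ → ℕ → Set where
  []  : Blocks A 0 0
  _∷_ : ∀ {m n n′} → (∃ λ (τ : Template A n) → HasVariable τ) →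
        Blocks A m n′ → Blocks A (suc m) (n + n′)

fill : ∀ {A m n} → Blocks A m n → Vec A m → Vec A n
fill []            []      = []
fill ((τ , _) ∷ S) (a ∷ v) = τ ⟨ a ⟩ ++ fill S v

fillLetter : ∀ {A n} → Template A n → Maybe A → Template A n
fillLetter τ (just a) = Vec.map just (τ ⟨ a ⟩)
fillLetter τ nothing  = τ

-- Composition of a line with a subspace: the variables of all blocks that receive `nothing` are
-- identified.
fillTemplate : ∀ {A m n} → Blocks A m n → Template A m → Template A n
fillTemplate []            []      = []
fillTemplate ((τ , _) ∷ S) (x ∷ σ) = fillLetter τ x ++ fillTemplate S σ

fillTemplate-hasVariable : ∀ {A m n} (S : Blocks A m n) (σ : Template A m) →
  HasVariable σ → HasVariable (fillTemplate S σ)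
fillTemplate-hasVariable ((τ , h) ∷ S) (_ ∷ σ) (here refl) = ++⁺ˡ h
fillTemplate-hasVariable ((τ , h) ∷ S) (x ∷ σ) (there k) =
  ++⁺ʳ (fillLetter τ x) (fillTemplate-hasVariable S σ k)

fillLetter-⟨⟩ : ∀ {A n} (τ : Template A n) (x : Maybe A) (a : A) →
  fillLetter τ x ⟨ a ⟩ ≡ τ ⟨ fromMaybe a x ⟩
fillLetter-⟨⟩ τ nothing  a = refl
fillLetter-⟨⟩ τ (just b) a = trans (sym (map-∘ _ just (τ ⟨ b ⟩))) (map-id _)

fillTemplate-⟨⟩ : ∀ {A m n} (S : Blocks A m n) (σ : Template A m) (a : A) →
  fillTemplate S σ ⟨ a ⟩ ≡ fill S (σ ⟨ a ⟩)
fillTemplate-⟨⟩ []            []      a = refl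
fillTemplate-⟨⟩ ((τ , _) ∷ S) (x ∷ σ) a =
  trans (map-++ _ (fillLetter τ x) (fillTemplate S σ))
        (cong₂ _++_ (fillLetter-⟨⟩ τ x a) (fillTemplate-⟨⟩ S σ a))

module _ {A B : Set} (g : A → B) where

  mapTemplate : ∀ {n} → Template A n → Template B n
  mapTemplate = Vec.map (Maybe.map g)

  mapTemplate-hasVariable : ∀ {n} (τ : Template A n) → HasVariable τ → HasVariable (mapTemplate τ)
  mapTemplate-hasVariable (_ ∷ τ) (here refl) = here refl
  mapTemplate-hasVariable (_ ∷ τ) (there h)   = there (mapTemplate-hasVariable τ h)

  mapBlocks : ∀ {m n} → Blocks A m n → Blocks B m n
  mapBlocks []            = []
  mapBlocks ((τ , h) ∷ S) = (mapTemplate τ , mapTemplate-hasVariable τ h) ∷ mapBlocks S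

  mapTemplate-⟨⟩ : ∀ {n} (τ : Template A n) a → mapTemplate τ ⟨ g a ⟩ ≡ Vec.map g (τ ⟨ a ⟩)
  mapTemplate-⟨⟩ []            a = refl
  mapTemplate-⟨⟩ (nothing ∷ τ) a = cong (g a ∷_) (mapTemplate-⟨⟩ τ a)
  mapTemplate-⟨⟩ (just b ∷ τ)  a = cong (g b ∷_) (mapTemplate-⟨⟩ τ a)

  fill-mapBlocks : ∀ {m n} (S : Blocks A m n) v → fill (mapBlocks S) (Vec.map g v) ≡ Vec.map g (fill S v)
  fill-mapBlocks []            []      = refl
  fill-mapBlocks ((τ , _) ∷ S) (a ∷ v) =
    trans (cong₂ _++_ (mapTemplate-⟨⟩ τ a) (fill-mapBlocks S v)) (sym (map-++ g (τ ⟨ a ⟩) (fill S v)))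

HalesJewett : ℕ → ℕ → Set
HalesJewett r c = ∃[ n ] ((χ : Vec (Fin (suc r)) n → Fin c) →
  ∃ λ (τ : Template (Fin (suc r)) n) → HasVariable τ × ∀ a b → χ (τ ⟨ a ⟩) ≡ χ (τ ⟨ b ⟩))

BlockHalesJewett : ℕ → ℕ → ℕ → Set
BlockHalesJewett r m c = ∃[ n ] ((χ : Vec (Fin (suc r)) n → Fin c) →
  ∃ λ (S : Blocks (Fin (suc r)) m n) → ∀ v w → χ (fill S v) ≡ χ (fill S w))

-- Induction on `m`. A word u in the first block is coloured by the whole map v ↦ χ(u ++ v), one of
-- `c ^ (suc r ^ n₂)` maps; along a monochromatic line the letter in the first block does not
-- influence χ, whatever follows.
blockHalesJewett : ∀ {r} → (∀ c → HalesJewett r c) → ∀ m c → BlockHalesJewett r m c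
blockHalesJewett hj zero    c = 0 , λ χ → [] , λ { [] [] → refl }
blockHalesJewett {r} hj (suc m) c with blockHalesJewett hj m c
... | n₂ , block with hj (c ^ (suc r ^ n₂))
... | n₁ , line = n₁ + n₂ , λ χ →
  let
    decode : Fin (suc r ^ n₂) → Vec (Fin (suc r)) n₂
    decode i = tabulate (finToFun i)
    encode : Vec (Fin (suc r)) n₂ → Fin (suc r ^ n₂)
    encode v = funToFin (lookup v)
    decode-encode : ∀ v → decode (encode v) ≡ v
    decode-encode v = trans (tabulate-cong (finToFun-funToFin (lookup v))) (tabulate∘lookup v)
    τ , h , mono = line (λ u → funToFin (λ i → χ (u ++ decode i)))
    S , mono′ = block (λ v → χ (τ ⟨ zero ⟩ ++ v))
    mono″ : ∀ a b v → χ (τ ⟨ a ⟩ ++ v) ≡ χ (τ ⟨ b ⟩ ++ v)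
    mono″ a b v = subst (λ v → χ (τ ⟨ a ⟩ ++ v) ≡ χ (τ ⟨ b ⟩ ++ v)) (decode-encode v)
      (trans (sym (finToFun-funToFin (λ i → χ (τ ⟨ a ⟩ ++ decode i)) (encode v)))
        (trans (cong (λ k → finToFun k (encode v)) (mono a b))
          (finToFun-funToFin (λ i → χ (τ ⟨ b ⟩ ++ decode i)) (encode v))))
  in (τ , h) ∷ S , λ { (a ∷ v) (b ∷ w) →
       trans (mono″ a zero (fill S v)) (trans (mono′ v w) (mono″ zero b (fill S w))) }

abstractZero : ∀ {r n} → Vec (Fin (suc r)) n → Template (Fin (suc r)) n
abstractZero = Vec.map λ { zero → nothing ; (suc b) → just (suc b) }

abstractZero-hasVariable : ∀ {r n} (v : Vec (Fin (suc r)) n) → Any (_≡ zero) v →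
  HasVariable (abstractZero v)
abstractZero-hasVariable (_ ∷ v) (here refl) = here refl
abstractZero-hasVariable (_ ∷ v) (there h)   = there (abstractZero-hasVariable v h)

abstractZero-⟨zero⟩ : ∀ {r n} (v : Vec (Fin (suc r)) n) → abstractZero v ⟨ zero ⟩ ≡ v
abstractZero-⟨zero⟩ []          = refl
abstractZero-⟨zero⟩ (zero ∷ v)  = cong (zero ∷_) (abstractZero-⟨zero⟩ v)
abstractZero-⟨zero⟩ (suc b ∷ v) = cong (suc b ∷_) (abstractZero-⟨zero⟩ v)

abstractZero-⟨suc⟩ : ∀ {r n} (v : Vec (Fin (suc r)) n) a →
  ∃ λ u → abstractZero v ⟨ suc a ⟩ ≡ Vec.map suc u
abstractZero-⟨suc⟩ []          a = [] , refl
abstractZero-⟨suc⟩ (zero ∷ v)  a = let u , e = abstractZero-⟨suc⟩ v a in a ∷ u , cong (suc a ∷_) e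
abstractZero-⟨suc⟩ (suc b ∷ v) a = let u , e = abstractZero-⟨suc⟩ v a in b ∷ u , cong (suc b ∷_) e

-- On a large block subspace the words without the letter zero share a colour.
-- If some word containing zero has that colour too, its zeros are the variable
-- of a monochromatic line; otherwise the words containing zero use one colour
-- less.
halesJewett : ExcludedMiddle 0ℓ → ∀ r c → HalesJewett r c
halesJewett em zero    c = 1 , λ χ → nothing ∷ [] , here refl , λ { zero zero → refl }
halesJewett em (suc r) zero    = 0 , λ χ → ⊥-elim (no-colour (χ []))
  where no-colour : ¬ Fin 0
        no-colour ()
halesJewett em (suc r) (suc c) with halesJewett em (suc r) c
-- One block more than `line` needs: it is kept at `zero`, so that every word on the line of the
-- last case contains `zero`.
... | n′ , line with blockHalesJewett (halesJewett em r) (suc n′) (suc c)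
... | n , block = n , result
  where
  result : (χ : Vec (Fin (2 + r)) n → Fin (suc c)) →
    ∃ λ (τ : Template (Fin (2 + r)) n) → HasVariable τ × ∀ a b → χ (τ ⟨ a ⟩) ≡ χ (τ ⟨ b ⟩)
  result χ with block (χ ∘ Vec.map suc)
  ... | S , mono with em {∃ λ v → Any (_≡ zero) v
      × χ (fill (mapBlocks suc S) v) ≡ χ (Vec.map suc (fill S (Vec.replicate _ zero)))}
  ... | yes (v , z , e) = fillTemplate S′ (abstractZero v)
      , fillTemplate-hasVariable S′ _ (abstractZero-hasVariable v z)
      , λ a b → trans (colour a) (sym (colour b))
    where
    S′ = mapBlocks suc S
    colour : ∀ a → χ (fillTemplate S′ (abstractZero v) ⟨ a ⟩) ≡ χ (Vec.map suc (fill S (Vec.replicate _ zero)))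
    colour zero = trans (cong χ (trans (fillTemplate-⟨⟩ S′ _ zero) (cong (fill S′) (abstractZero-⟨zero⟩ v)))) e
    colour (suc a) with abstractZero-⟨suc⟩ v a
    ... | u , eq = trans
      (cong χ (trans (fillTemplate-⟨⟩ S′ _ (suc a)) (trans (cong (fill S′) eq) (fill-mapBlocks suc S u))))
      (mono u _)
  ... | no ∄v = let τ , h , mono′ = line χ′ in
      fillTemplate S′ (just zero ∷ τ) , fillTemplate-hasVariable S′ (just zero ∷ τ) (there h)
      , λ a b → trans (cong χ (fillTemplate-⟨⟩ S′ (just zero ∷ τ) a))
          (trans (punchOut-injective (avoid _) (avoid _) (mono′ a b))
            (sym (cong χ (fillTemplate-⟨⟩ S′ (just zero ∷ τ) b))))
    where
    S′ = mapBlocks suc S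
    avoid : ∀ w → χ (Vec.map suc (fill S (Vec.replicate _ zero))) ≢ χ (fill S′ (zero ∷ w))
    avoid w e = ∄v (zero ∷ w , here refl , sym e)
    χ′ : Vec (Fin (2 + r)) n′ → Fin c
    χ′ w = punchOut (avoid w)

-- Subsets, filters and ultrafilters

infix 4 _⊆_
_⊆_ : ∀ {X} → Subset X → Subset X → Set
A ⊆ B = ∀ x → x ∈ A → x ∈ B

infixr 7 _∩_
_∩_ : ∀ {X} → Subset X → Subset X → Subset X
(A ∩ B) x = A x ∧ B x

∁ : ∀ {X} → Subset X → Subset X
∁ A x = not (A x)

∈-∩⁺ : ∀ {X} (A B : Subset X) x → x ∈ A → x ∈ B → x ∈ A ∩ B
∈-∩⁺ A B x a b = Equivalence.from T-∧ (a , b)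

∈-∩⁻ : ∀ {X} (A B : Subset X) x → x ∈ A ∩ B → x ∈ A × x ∈ B
∈-∩⁻ A B x = Equivalence.to T-∧

∈-∁⁺ : ∀ {X} {A : Subset X} {x} → ¬ x ∈ A → x ∈ ∁ A
∈-∁⁺ {A = A} {x} h with A x
... | true  = h tt
... | false = tt

∈-∁⁻ : ∀ {X} {A : Subset X} {x} → x ∈ ∁ A → ¬ x ∈ A
∈-∁⁻ {A = A} {x} h with A x
... | false = id

record IsFilter {X : Set} (F : Subset (Subset X)) : Set where
  field
    full   : (λ _ → true) ∈ F
    proper : ¬ ((λ _ → false) ∈ F)
    upward : ∀ {A B} → A ∈ F → A ⊆ B → B ∈ F
    inter  : ∀ {A B} → A ∈ F → B ∈ F → A ∩ B ∈ F

ultrafilter-isFilter : ∀ {X} (p : Ultrafilter X) → IsFilter (sets p)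
ultrafilter-isFilter p = record
  { full = full ; proper = proper ; upward = λ a s → upward _ _ a s ; inter = inter _ _ }
  where open Ultrafilter p

∁-∉ : ∀ {X} (p : Ultrafilter X) {A} → ∁ A ∈ sets p → ¬ A ∈ sets p
∁-∉ p {A} h k = Ultrafilter.proper p (Ultrafilter.upward p _ _ (Ultrafilter.inter p _ _ k h)
  λ x l → let (a , b) = ∈-∩⁻ A (∁ A) x l in ⊥-elim (∈-∁⁻ {A = A} {x} b a))

∉-∁ : ∀ {X} (p : Ultrafilter X) {A} → ¬ A ∈ sets p → ∁ A ∈ sets p
∉-∁ p {A} h with Ultrafilter.ultra p A
... | inj₁ a = ⊥-elim (h a)
... | inj₂ b = b

value-injective : ∀ {x y} → value x ≡ value y → x ≡ y
value-injective refl = refl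

+⁺-assoc : ∀ x y z → x +⁺ y +⁺ z ≡ x +⁺ (y +⁺ z)
+⁺-assoc x y z = value-injective (+-assoc (value x) (value y) (value z))

+⁺-comm : ∀ x y → x +⁺ y ≡ y +⁺ x
+⁺-comm x y = value-injective (+-comm (value x) (value y))

-- The set -x + A.
translate : ℕ⁺ → Subset ℕ⁺ → Subset ℕ⁺
translate x A y = A (x +⁺ y)

translate-+⁺ : ∀ x y A → translate (x +⁺ y) A ⊆ translate y (translate x A)
translate-+⁺ x y A z = subst (_∈ A) (+⁺-assoc x y z)

translate-+⁺⁻ : ∀ x y A → translate y (translate x A) ⊆ translate (x +⁺ y) A
translate-+⁺⁻ x y A z = subst (_∈ A) (sym (+⁺-assoc x y z))

-- The filter version of a closed subsemigroup: if p and q contain `F`, the condition puts every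
-- member of `F` into p + q.
record IsIdempotentFilter (F : Subset (Subset ℕ⁺)) : Set where
  field
    isFilter   : IsFilter F
    idempotent : ∀ {A} → A ∈ F → (λ x → F (translate x A)) ∈ F
  open IsFilter isFilter public

-- Finite sums and finite sets of positive integers

infixl 6 _+₀_
_+₀_ : ℕ⁺ → ℕ → ℕ⁺
pos m +₀ n = pos (m + n) {{+-nonZeroˡ m n}}

value-foldr₁ : ∀ xs → value (foldr₁ _+⁺_ xs) ≡ sum (map value (toList xs))
value-foldr₁ (x ∷⁺ xs) = go x xs
  where
  go : ∀ x xs → value (foldr₁ _+⁺_ (x ∷⁺ xs)) ≡ sum (map value (x ∷ xs))
  go x []       = sym (+-identityʳ _)
  go x (y ∷ xs) = cong (value x +_) (go y xs)

value-∑ : ∀ {X} (β : 𝒫f X) f → value (∑ β f) ≡ sum (map (value ∘ f) (toList (elements β)))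
value-∑ β f = trans (value-foldr₁ (List⁺.map f (elements β)))
  (cong sum (sym (mapₗ-∘ (toList (elements β)))))

sum-map-+ : ∀ {X : Set} (g h : X → ℕ) xs →
  sum (map (λ x → g x + h x) xs) ≡ sum (map g xs) + sum (map h xs)
sum-map-+ g h []       = refl
sum-map-+ g h (x ∷ xs) = begin
  g x + h x + sum (map (λ x → g x + h x) xs)        ≡⟨ cong (g x + h x +_) (sum-map-+ g h xs) ⟩
  g x + h x + (sum (map g xs) + sum (map h xs))     ≡⟨ +-assoc (g x) (h x) _ ⟩
  g x + (h x + (sum (map g xs) + sum (map h xs)))   ≡⟨ cong (g x +_) (+-assoc (h x) _ _) ⟨
  g x + (h x + sum (map g xs) + sum (map h xs))     ≡⟨ cong (λ k → g x + (k + sum (map h xs))) (+-comm (h x) _) ⟩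
  g x + (sum (map g xs) + h x + sum (map h xs))     ≡⟨ cong (g x +_) (+-assoc (sum (map g xs)) (h x) _) ⟩
  g x + (sum (map g xs) + (h x + sum (map h xs)))   ≡⟨ +-assoc (g x) _ _ ⟨
  g x + sum (map g xs) + (h x + sum (map h xs))     ∎
  where open ≡-Reasoning

sum-map-suc : ∀ {X : Set} (g : X → ℕ) xs → sum (map (suc ∘ g) xs) ≡ length xs + sum (map g xs)
sum-map-suc g []       = refl
sum-map-suc g (x ∷ xs) = cong suc (begin
  g x + sum (map (suc ∘ g) xs)       ≡⟨ cong (g x +_) (sum-map-suc g xs) ⟩
  g x + (length xs + sum (map g xs)) ≡⟨ +-assoc (g x) _ _ ⟨
  g x + length xs + sum (map g xs)   ≡⟨ cong (_+ sum (map g xs)) (+-comm (g x) _) ⟩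
  length xs + g x + sum (map g xs)   ≡⟨ +-assoc (length xs) _ _ ⟩
  length xs + (g x + sum (map g xs)) ∎)
  where open ≡-Reasoning

𝒫f-of-list : ∀ {X} {x : X} (xs : List X) → x ∈ₗ xs → Unique xs →
  ∃ λ (β : 𝒫f X) → toList (elements β) ≡ xs
𝒫f-of-list (x ∷ xs) _ unique = mk𝒫f (x ∷⁺ xs) unique , refl

∈⇒≤max : ∀ {x} β → x ∈f β → value x ≤ max β
∈⇒≤max (mk𝒫f (y ∷⁺ ys) _) = go y ys
  where
  go : ∀ {x} y ys → x ∈ₗ y ∷ ys → value x ≤ foldr₁ _⊔_ (List⁺.map value (y ∷⁺ ys))
  go y []       (hereₗ refl) = ≤-refl
  go y (z ∷ zs) (hereₗ refl) = m≤m⊔n _ _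
  go y (z ∷ zs) (thereₗ m)   = ≤-trans (go z zs m) (m≤n⊔m (value y) _)

∈⇒min≤ : ∀ {x} β → x ∈f β → min β ≤ value x
∈⇒min≤ (mk𝒫f (y ∷⁺ ys) _) = go y ys
  where
  go : ∀ {x} y ys → x ∈ₗ y ∷ ys → foldr₁ _⊓_ (List⁺.map value (y ∷⁺ ys)) ≤ value x
  go y []       (hereₗ refl) = ≤-refl
  go y (z ∷ zs) (hereₗ refl) = m⊓n≤m _ _
  go y (z ∷ zs) (thereₗ m)   = ≤-trans (m⊓n≤n (value y) _) (go z zs m)

max-least : ∀ {n} β → (∀ x → x ∈f β → value x ≤ n) → max β ≤ n
max-least (mk𝒫f (y ∷⁺ ys) _) = go y ys
  where
  go : ∀ {n} y ys → (∀ x → x ∈ₗ y ∷ ys → value x ≤ n) → foldr₁ _⊔_ (List⁺.map value (y ∷⁺ ys)) ≤ n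
  go y []       h = h y (hereₗ refl)
  go y (z ∷ zs) h = ⊔-lub (h y (hereₗ refl)) (go z zs λ x → h x ∘ thereₗ)

min-greatest : ∀ {n} β → (∀ x → x ∈f β → n < value x) → n < min β
min-greatest (mk𝒫f (y ∷⁺ ys) _) = go y ys
  where
  go : ∀ {n} y ys → (∀ x → x ∈ₗ y ∷ ys → n < value x) → n < foldr₁ _⊓_ (List⁺.map value (y ∷⁺ ys))
  go y []       h = h y (hereₗ refl)
  go y (z ∷ zs) h = ⊓-glb (h y (hereₗ refl)) (go z zs λ x → h x ∘ thereₗ)

IsJSet-⊆ : ∀ A B → IsJSet A → A ⊆ B → IsJSet B
IsJSet-⊆ A B J A⊆B F = let (a , β , h) = J F in a , β , λ f → A⊆B _ ∘ h f

IsJSet-translate : ∀ x A → IsJSet (translate x A) → IsJSet A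
IsJSet-translate x A J F = let (a , β , h) = J F in
  x +⁺ a , β , λ f m → subst (_∈ A) (sym (+⁺-assoc x a (∑ β f))) (h f m)

principal : ∀ {X} → X → Ultrafilter X
principal x = record
  { sets = λ A → A x ; full = tt ; proper = id ; upward = λ _ _ a s → s x a
  ; inter = λ A B → ∈-∩⁺ A B x ; ultra = ultra }
  where
  ultra : ∀ A → x ∈ A ⊎ x ∈ ∁ A
  ultra A with A x
  ... | true  = inj₁ tt
  ... | false = inj₂ tt

-- The tensor product with the recursion on the first coordinate.
Prod : ∀ m → (Fin m → Ultrafilter ℕ⁺) → Ultrafilter (Vec ℕ⁺ m)
Prod zero    p = principal []
Prod (suc m) p = extend _∷_ (p zero) (Prod m (p ∘ suc))

-- Chains of sets of functions and their sums

⊊-trans : ∀ {X} (F G K : 𝒫f X) → F ⊊ G → G ⊊ K → F ⊊ K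
⊊-trans F G K (F⊆G , F≉G) (G⊆K , _) = G⊆K ∘ F⊆G , λ (_ , K⊆F) → F≉G (F⊆G , K⊆F ∘ G⊆K)

Functions : Set
Functions = 𝒫f (ℕ⁺ → ℕ⁺)

-- One step of a chain in (b): a set Gᵢ with the chosen fᵢ.
Entry : Set
Entry = ∃ λ (G : Functions) → ∃ λ f → f ∈f G

infix 4 _≺_
_≺_ : Functions → Entry → Set
F ≺ (G , _) = F ⊊ G

≺-lower : ∀ F K {es} → F ⊊ K → All (K ≺_) es → All (F ≺_) es
≺-lower F K F⊊K = All.map λ {e} → ⊊-trans F K (proj₁ e) F⊊K

Increasing : List Entry → Set
Increasing = AllPairs λ e e′ → proj₁ e ⊊ proj₁ e′

term : (Functions → ℕ⁺) → (Functions → 𝒫f ℕ⁺) → Entry → ℕ⁺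
term α H (G , f , _) = α G +⁺ ∑ (H G) f

total : (Entry → ℕ⁺) → List⁺ Entry → ℕ⁺
total φ l = foldr₁ _+⁺_ (List⁺.map φ l)

value-total : ∀ φ l → value (total φ l) ≡ sum (map (value ∘ φ) (toList l))
value-total φ l = trans (value-foldr₁ (List⁺.map φ l)) (cong sum (sym (mapₗ-∘ (toList l))))

total-++ : ∀ φ l l′ → total φ (l ⁺++⁺ l′) ≡ total φ l +⁺ total φ l′
total-++ φ l l′ = value-injective (begin
  value (total φ (l ⁺++⁺ l′))                           ≡⟨ value-total φ (l ⁺++⁺ l′) ⟩
  sum (map (value ∘ φ) (toList l ++ₗ toList l′))        ≡⟨ cong sum (mapₗ-++ (value ∘ φ) (toList l) (toList l′)) ⟩
  sum (map (value ∘ φ) (toList l) ++ₗ map (value ∘ φ) (toList l′)) ≡⟨ sum-++ (map (value ∘ φ) (toList l)) _ ⟩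
  sum (map (value ∘ φ) (toList l)) + sum (map (value ∘ φ) (toList l′)) ≡⟨ cong₂ _+_ (value-total φ l) (value-total φ l′) ⟨
  value (total φ l) + value (total φ l′)                ∎)
  where open ≡-Reasoning

totals : ∀ {m} → (Fin m → Entry → ℕ⁺) → Vec (List⁺ Entry) m → Vec ℕ⁺ m
totals φ []       = []
totals φ (l ∷ ls) = total (φ zero) l ∷ totals (φ ∘ suc) ls

concatAll : ∀ {m} → Vec (List⁺ Entry) m → List Entry
concatAll []       = []
concatAll (l ∷ ls) = toList l ++ₗ concatAll ls

-- A default is needed because (b) speaks of a sequence indexed by all positive integers, while a
-- chain is finite.
at : Entry → List Entry → ℕ → Entry
at e []       s       = e
at e (x ∷ xs) zero    = x
at e (x ∷ xs) (suc s) = at e xs s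

at-∈ : ∀ {P : Entry → Set} {e xs} → All P xs → ∀ {s} → s < length xs → P (at e xs s)
at-∈ (h ∷ hs) {zero}  _         = h
at-∈ (h ∷ hs) {suc s} (s≤s s<l) = at-∈ hs s<l

at-Increasing : ∀ {e xs} → Increasing xs → ∀ {s t} → s < t → t < length xs →
  proj₁ (at e xs s) ⊊ proj₁ (at e xs t)
at-Increasing (h ∷ hs) {zero}  {suc t} _         (s≤s t<l) = at-∈ h t<l
at-Increasing (h ∷ hs) {suc s} {suc t} (s≤s s<t) (s≤s t<l) = at-Increasing hs s<t t<l

Agrees : (ℕ → Entry) → ℕ → List Entry → Set
Agrees E o []       = ⊤
Agrees E o (x ∷ xs) = E o ≡ x × Agrees E (suc o) xs

agrees-at : ∀ {e} E o xs → (∀ s → E (o + s) ≡ at e xs s) → Agrees E o xs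
agrees-at E o []       h = tt
agrees-at E o (x ∷ xs) h = trans (cong E (sym (+-identityʳ o))) (h 0)
  , agrees-at E (suc o) xs λ s → trans (cong E (sym (+-suc o s))) (h (suc s))

agrees-++⁻ : ∀ E o xs {ys} → Agrees E o (xs ++ₗ ys) → Agrees E o xs × Agrees E (o + length xs) ys
agrees-++⁻ E o []       {ys} h       = tt , subst (λ o → Agrees E o ys) (sym (+-identityʳ o)) h
agrees-++⁻ E o (x ∷ xs) {ys} (e , h) = let (h₁ , h₂) = agrees-++⁻ E (suc o) xs {ys} h in
  (e , h₁) , subst (λ o → Agrees E o ys) (sym (+-suc o (length xs))) h₂

-- The positions o + 1, ..., o + n. List positions count from 0 and elements of β from 1, whence
-- `pred` in `total-block`.
interval : ℕ → ℕ → List ℕ⁺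
interval o zero    = []
interval o (suc n) = pos (suc o) ∷ interval (suc o) n

∈-interval : ∀ o n {x} → x ∈ₗ interval o n → o < value x × value x ≤ o + n
∈-interval o (suc n) (hereₗ refl) = ≤-refl , subst (suc o ≤_) (sym (+-suc o n)) (s≤s (m≤m+n o n))
∈-interval o (suc n) {x} (thereₗ m)   = let (l , u) = ∈-interval (suc o) n m in
  <⇒≤ l , subst (value x ≤_) (sym (+-suc o n)) u

interval-unique : ∀ o n → Unique (interval o n)
interval-unique o zero    = []
interval-unique o (suc n) = All.tabulate (λ { m refl → <-irrefl refl (proj₁ (∈-interval (suc o) n m)) })
  ∷ interval-unique (suc o) n

block : ℕ → List⁺ Entry → 𝒫f ℕ⁺
block o (x ∷⁺ xs) = mk𝒫f (pos (suc o) ∷⁺ interval (suc o) (length xs)) (interval-unique o (suc (length xs)))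

∈-block : ∀ o l {x} → x ∈f block o l → o < value x × value x ≤ o + length (toList l)
∈-block o (x ∷⁺ xs) = ∈-interval o (suc (length xs))

blocks : ∀ {m} → ℕ → Vec (List⁺ Entry) m → Fin m → 𝒫f ℕ⁺
blocks o (l ∷ ls) zero    = block o l
blocks o (l ∷ ls) (suc j) = blocks (o + length (toList l)) ls j

∈-blocks : ∀ {m} o (ls : Vec (List⁺ Entry) m) j {x} → x ∈f blocks o ls j →
  o < value x × value x ≤ o + length (concatAll ls)
∈-blocks o (l ∷ ls) j m with
  subst (λ n → o + length (toList l) ≤ o + n × o + length (toList l) + length (concatAll ls) ≡ o + n)
    (sym (lengthₗ-++ (toList l) {concatAll ls}))
    (+-monoʳ-≤ o (m≤m+n (length (toList l)) _) , +-assoc o (length (toList l)) (length (concatAll ls)))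
∈-blocks o (l ∷ ls) zero    m | le , _ = let (a , b) = ∈-block o l m in a , ≤-trans b le
∈-blocks o (l ∷ ls) (suc j) m | _ , eq = let (a , b) = ∈-blocks (o + length (toList l)) ls j m in
  ≤-trans (s≤s (m≤m+n o _)) a , ≤-trans b (≤-reflexive eq)

blocks-increasing : ∀ {m} o (ls : Vec (List⁺ Entry) m) i j → i Fin.< j → blocks o ls i <f blocks o ls j
blocks-increasing o (l ∷ ls) zero (suc j) _ = ≤-trans
  (s≤s (max-least (block o l) λ x → proj₂ ∘ ∈-block o l))
  (min-greatest (blocks _ ls j) λ x → proj₁ ∘ ∈-blocks _ ls j)
blocks-increasing o (l ∷ ls) (suc i) (suc j) (s≤s i<j) = blocks-increasing _ ls i j i<j

total-block : ∀ φ E o l → Agrees E o (toList l) → ∑ (block o l) (λ i → φ (E (pred (value i)))) ≡ total φ l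
total-block φ E o (x ∷⁺ xs) (e , h) = cong₂ (λ y ys → foldr₁ _+⁺_ (y ∷⁺ ys)) (cong φ e) (go (suc o) xs h)
  where
  go : ∀ o xs → Agrees E o xs → map (λ i → φ (E (pred (value i)))) (interval o (length xs)) ≡ map φ xs
  go o []       _       = refl
  go o (x ∷ xs) (e , h) = cong₂ _∷_ (cong φ e) (go (suc o) xs h)

totals-blocks : ∀ {m} (φ : Fin m → Entry → ℕ⁺) E o ls → Agrees E o (concatAll ls) →
  tabulate (λ j → ∑ (blocks o ls j) (λ i → φ j (E (pred (value i))))) ≡ totals φ ls
totals-blocks φ E o []       h = refl
totals-blocks φ E o (l ∷ ls) h = let (h₁ , h₂) = agrees-++⁻ E o (toList l) {concatAll ls} h in
  cong₂ _∷_ (total-block (φ zero) E o l h₁) (totals-blocks (φ ∘ suc) E _ ls h₂)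

length-concatAll : ∀ {m} (ls : Vec (List⁺ Entry) m) → m ≤ length (concatAll ls)
length-concatAll []               = z≤n
length-concatAll ((x ∷⁺ xs) ∷ ls) = s≤s (≤-trans (length-concatAll ls)
  (subst (length (concatAll ls) ≤_) (sym (lengthₗ-++ xs)) (m≤n+m _ (length xs))))

-- Counting, sorting and finite intersections

unique-⊆⇒length≤ : ∀ {X : Set} {xs ys : List X} →
  Unique xs → (∀ {x} → x ∈ₗ xs → x ∈ₗ ys) → length xs ≤ length ys
unique-⊆⇒length≤ [] _ = z≤n
unique-⊆⇒length≤ {xs = x ∷ xs} (x∉xs ∷ u) xs⊆ys with ∈-∃++ (xs⊆ys (hereₗ refl))
... | as , bs , refl = begin
    suc (length xs)               ≤⟨ s≤s (unique-⊆⇒length≤ u λ m → remove m (∈-++⁻ as (xs⊆ys (thereₗ m)))) ⟩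
    suc (length (as ++ₗ bs))      ≡⟨ cong suc (lengthₗ-++ as) ⟩
    suc (length as + length bs)   ≡⟨ +-suc (length as) (length bs) ⟨
    length as + suc (length bs)   ≡⟨ lengthₗ-++ as ⟨
    length (as ++ₗ x ∷ bs)        ∎
  where
  open ≤-Reasoning
  remove : ∀ {y} → y ∈ₗ xs → y ∈ₗ as ⊎ y ∈ₗ x ∷ bs → y ∈ₗ as ++ₗ bs
  remove m (inj₁ h)            = ∈-++⁺ˡ h
  remove m (inj₂ (hereₗ refl)) = ⊥-elim (All.lookup x∉xs m refl)
  remove m (inj₂ (thereₗ h))   = ∈-++⁺ʳ as h

powerlist : ∀ {X : Set} → List X → List (List X)
powerlist []       = [] ∷ []
powerlist (x ∷ xs) = map (x ∷_) (powerlist xs) ++ₗ powerlist xs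

-- In (2) ⇒ (1) chains are listed from the top, since the recursion adds each new set at the head;
-- positions are sorted to match.
descending-order : DecTotalOrder _ _ _
descending-order = On.decTotalOrder (Flip.decTotalOrder ≤-decTotalOrder) value

open Sort descending-order using (sort; sort-↭; sort-↗)

sort-descending : ∀ {xs} → Unique xs → AllPairs (λ i j → value j < value i) (sort xs)
sort-descending {xs} u = AllPairs.zipWith (λ { (j≤i , i≢j) → ≤∧≢⇒< j≤i (i≢j ∘ sym ∘ value-injective) })
  ( Sorted⇒AllPairs (DecTotalOrder.totalOrder descending-order) (sort-↗ xs)
  , Permutation.Unique-resp-↭ (setoid ℕ⁺) (↭⇒↭ₛ (↭-sym (sort-↭ xs))) u)

⋂ : ∀ {I X : Set} → (I → Subset X) → List I → Subset X
⋂ S []       x = true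
⋂ S (i ∷ is)   = S i ∩ ⋂ S is

∈-⋂⁻ : ∀ {I X : Set} (S : I → Subset X) {is x} → x ∈ ⋂ S is → ∀ {i} → i ∈ₗ is → x ∈ S i
∈-⋂⁻ S {i ∷ is} {x} h (hereₗ refl) = proj₁ (∈-∩⁻ (S i) (⋂ S is) x h)
∈-⋂⁻ S {i ∷ is} {x} h (thereₗ m)   = ∈-⋂⁻ S (proj₂ (∈-∩⁻ (S i) (⋂ S is) x h)) m

⋂-∈ : ∀ {I X : Set} (p : Ultrafilter X) (S : I → Subset X) is → (∀ i → i ∈ₗ is → S i ∈ sets p) → ⋂ S is ∈ sets p
⋂-∈ p S []       h = Ultrafilter.full p
⋂-∈ p S (i ∷ is) h = Ultrafilter.inter p _ _ (h i (hereₗ refl)) (⋂-∈ p S is λ j → h j ∘ thereₗ)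

Descending : List Entry → Set
Descending = AllPairs λ e e′ → proj₁ e′ ⊊ proj₁ e

top bottom : List⁺ Entry → Functions
top    = proj₁ ∘ List⁺.head
bottom = List⁺.foldr (λ _ F → F) proj₁

bottom-All : ∀ {P : Functions → Set} l → All (P ∘ proj₁) (toList l) → P (bottom l)
bottom-All {P} (e ∷⁺ es) = go e es
  where
  go : ∀ e es → All (P ∘ proj₁) (e ∷ es) → P (bottom (e ∷⁺ es))
  go e []        (h ∷ _)  = h
  go e (e′ ∷ es) (_ ∷ hs) = go e′ es hs

record Choice : Set where
  field
    shift   : ℕ⁺
    support : 𝒫f ℕ⁺
    -- The bottom and the total of each chain whose top is the present set.
    history : List (Functions × ℕ⁺)
open Choice

module Classical (em : ExcludedMiddle 0ℓ) (ext : Extensionality 0ℓ 0ℓ) where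

  stable : ∀ {P : Set} → ¬ ¬ P → P
  stable = decidable-stable em

  opaque
    ⟪_⟫ : ∀ {X} → (X → Set) → Subset X
    ⟪ P ⟫ x = ⌊ em {P x} ⌋

    ∈-⟪⟫⁺ : ∀ {X} (P : X → Set) {x} → P x → x ∈ ⟪ P ⟫
    ∈-⟪⟫⁺ P = fromWitness

    ∈-⟪⟫⁻ : ∀ {X} (P : X → Set) {x} → x ∈ ⟪ P ⟫ → P x
    ∈-⟪⟫⁻ P = toWitness

  ⊆-antisym : ∀ {X} {A B : Subset X} → A ⊆ B → B ⊆ A → A ≡ B
  ⊆-antisym {A = A} {B} A⊆B B⊆A = ext λ x → bool (A⊆B x) (B⊆A x)
    where
    bool : ∀ {a b} → (T a → T b) → (T b → T a) → a ≡ b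
    bool {true}  {true}  _ _ = refl
    bool {true}  {false} f _ = ⊥-elim (f tt)
    bool {false} {true}  _ g = ⊥-elim (g tt)
    bool {false} {false} _ _ = refl

  InUnion : ∀ {X} → Subset (Subset X) → X → Set
  InUnion C x = ∃ λ A → A ∈ C × x ∈ A

  ⋃ : ∀ {X} → Subset (Subset X) → Subset X
  ⋃ C = ⟪ InUnion C ⟫

  ∈-⋃⁺ : ∀ {X} {C : Subset (Subset X)} {A} → A ∈ C → A ⊆ ⋃ C
  ∈-⋃⁺ {C = C} A∈C x x∈A = ∈-⟪⟫⁺ (InUnion C) (_ , A∈C , x∈A)

  ∈-⋃⁻ : ∀ {X} {C : Subset (Subset X)} {x} → x ∈ ⋃ C → ∃ λ A → A ∈ C × x ∈ A
  ∈-⋃⁻ {C = C} = ∈-⟪⟫⁻ (InUnion C)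

  -- Zorn's lemma and ultrafilters

  -- Nonempty chains only, because the union of the empty chain is not a filter.
  record ChainClosed {X : Set} (Φ : Subset X → Set) : Set where
    field
      union : ∀ C → ∃ (_∈ C) → (∀ A → A ∈ C → Φ A) →
        (∀ A B → A ∈ C → B ∈ C → A ⊆ B ⊎ B ⊆ A) → Φ (⋃ C)

  module Zorn {X : Set} {Φ : Subset X → Set} (closed : ChainClosed Φ)
              (A₀ : Subset X) (ΦA₀ : Φ A₀) where

    Extension : Subset X → Set
    Extension A = ∃ λ B → Φ B × A ⊆ B × ¬ (B ⊆ A)

    -- The choice in Zorn's lemma: excluded middle, applied to the proposition `Extension A`, yields
    -- a definite larger set.
    next : Subset X → Subset X
    next A with em {Extension A}
    ... | yes (B , _) = B
    ... | no  _       = A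

    ⊆-next : ∀ A → A ⊆ next A
    ⊆-next A with em {Extension A}
    ... | yes (_ , _ , A⊆B , _) = A⊆B
    ... | no  _                 = λ _ → id

    next-Φ : ∀ {A} → Φ A → Φ (next A)
    next-Φ {A} ΦA with em {Extension A}
    ... | yes (_ , ΦB , _) = ΦB
    ... | no  _            = ΦA

    next-maximal : ∀ A → next A ⊆ A → ¬ Extension A
    next-maximal A h e with em {Extension A}
    ... | yes (_ , _ , _ , B⊈A) = B⊈A h
    ... | no  ¬e                = ¬e e

    -- The least family containing `A₀` and closed under `next` and nonempty unions, as in the
    -- Bourbaki-Witt argument. `lim` does not ask for a chain: that the whole tower is one is proved
    -- afterwards.
    data Tower : Subset X → Set where
      base : Tower A₀
      succ : ∀ {A} → Tower A → Tower (next A)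
      lim  : ∀ C → ∃ (_∈ C) → (∀ A → A ∈ C → Tower A) → Tower (⋃ C)

    ⊆-trans : ∀ {A B C : Subset X} → A ⊆ B → B ⊆ C → A ⊆ C
    ⊆-trans f g x = g x ∘ f x

    ⋃-least : ∀ {C : Subset (Subset X)} {B} → (∀ A → A ∈ C → A ⊆ B) → ⋃ C ⊆ B
    ⋃-least h x x∈ = let (A , A∈C , x∈A) = ∈-⋃⁻ x∈ in h A A∈C x x∈A

    A₀⊆ : ∀ {A} → Tower A → A₀ ⊆ A
    A₀⊆ base                  = λ _ → id
    A₀⊆ (succ t)              = ⊆-trans (A₀⊆ t) (⊆-next _)
    A₀⊆ (lim C (A , A∈C) t) = ⊆-trans (A₀⊆ (t A A∈C)) (∈-⋃⁺ A∈C)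

    -- Nothing jumps over `A`. This splits comparability into two inductions: on the other set when
    -- `A` is extreme, then on `A` to see that it is.
    Extreme : Subset X → Set
    Extreme A = ∀ {B} → Tower B → B ⊆ A → ¬ (A ⊆ B) → next B ⊆ A

    next-cong : ∀ {A B} → A ⊆ B → B ⊆ A → next A ⊆ next B
    next-cong f g = subst (λ C → _ ⊆ next C) (⊆-antisym f g) (λ _ → id)

    extreme-comparable : ∀ {A} → Tower A → Extreme A → ∀ {B} → Tower B → B ⊆ A ⊎ next A ⊆ B
    extreme-comparable t e base = inj₁ (A₀⊆ t)
    extreme-comparable {A} t e (succ {B} u) with extreme-comparable t e u
    ... | inj₂ h = inj₂ (⊆-trans h (⊆-next B))
    ... | inj₁ h with em {A ⊆ B}
    ...   | yes g = inj₂ (next-cong g h)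
    ...   | no ¬g = inj₁ (e u h ¬g)
    extreme-comparable {A} t e (lim C _ u) with em {∃ λ B → B ∈ C × next A ⊆ B}
    ... | yes (B , B∈C , h) = inj₂ (⊆-trans h (∈-⋃⁺ B∈C))
    ... | no ¬h = inj₁ (⋃-least below)
      where
      below : ∀ B → B ∈ C → B ⊆ A
      below B B∈C with extreme-comparable t e (u B B∈C)
      ... | inj₁ g = g
      ... | inj₂ g = ⊥-elim (¬h (B , B∈C , g))

    extreme : ∀ {A} → Tower A → Extreme A
    extreme base u _ ¬h = ⊥-elim (¬h (A₀⊆ u))
    extreme (succ {A} t) {B} u B⊆ ¬h with extreme-comparable t (extreme t) u
    ... | inj₂ g = ⊥-elim (¬h g)
    ... | inj₁ g with em {A ⊆ B}
    ...   | yes k = next-cong g k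
    ...   | no ¬k = ⊆-trans (extreme t u g ¬k) (⊆-next A)
    extreme (lim C _ t) {B} u B⊆ ¬h with em {∃ λ A → A ∈ C × ¬ (A ⊆ B)}
    ... | no ¬k = ⊥-elim (¬h (⋃-least λ A A∈C → stable λ ¬l → ¬k (A , A∈C , ¬l)))
    ... | yes (A , A∈C , A⊈B) with extreme-comparable (t A A∈C) (extreme (t A A∈C)) u
    ...   | inj₁ g = ⊆-trans (extreme (t A A∈C) u g A⊈B) (∈-⋃⁺ A∈C)
    ...   | inj₂ g = ⊥-elim (A⊈B (⊆-trans (⊆-next A) g))

    comparable : ∀ {A B} → Tower A → Tower B → A ⊆ B ⊎ B ⊆ A
    comparable t u with extreme-comparable t (extreme t) u
    ... | inj₁ h = inj₂ h
    ... | inj₂ h = inj₁ (⊆-trans (⊆-next _) h)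

    tower-Φ : ∀ {A} → Tower A → Φ A
    tower-Φ base        = ΦA₀
    tower-Φ (succ t)    = next-Φ (tower-Φ t)
    tower-Φ (lim C c t) = ChainClosed.union closed C c (λ A A∈C → tower-Φ (t A A∈C))
      λ A B A∈C B∈C → comparable (t A A∈C) (t B B∈C)

    tower-top : Tower (⋃ ⟪ Tower ⟫)
    tower-top = lim ⟪ Tower ⟫ (A₀ , ∈-⟪⟫⁺ Tower base) λ A → ∈-⟪⟫⁻ Tower

    maximal : ∃ λ A → A₀ ⊆ A × Φ A × ∀ B → Φ B → A ⊆ B → B ⊆ A
    -- The union of the tower belongs to the tower, hence contains its own `next`.
    maximal = ⋃ ⟪ Tower ⟫ , A₀⊆ tower-top , tower-Φ tower-top , λ B ΦB A⊆B →
      stable λ B⊈A → next-maximal _ (∈-⋃⁺ (∈-⟪⟫⁺ Tower (succ tower-top))) (B , ΦB , A⊆B , B⊈A)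

  open Zorn using (maximal) public

  isFilter-chainClosed : ∀ {X} → ChainClosed (IsFilter {X})
  isFilter-chainClosed .ChainClosed.union C (F , F∈C) filter chain = record
    { full   = ∈-⋃⁺ F∈C _ (IsFilter.full (filter F F∈C))
    ; proper = λ h → let (G , G∈C , k) = ∈-⋃⁻ h in IsFilter.proper (filter G G∈C) k
    ; upward = λ h A⊆B → let (G , G∈C , k) = ∈-⋃⁻ h in
        ∈-⋃⁺ G∈C _ (IsFilter.upward (filter G G∈C) k A⊆B)
    ; inter  = λ {A} {B} h h′ →
        let (G , G∈C , k) = ∈-⋃⁻ h ; (G′ , G′∈C , k′) = ∈-⋃⁻ h′ in both A B G∈C G′∈C k k′ (chain G G′ G∈C G′∈C)
    }
    where
    both : ∀ A B {G G′} → G ∈ C → G′ ∈ C → A ∈ G → B ∈ G′ → G ⊆ G′ ⊎ G′ ⊆ G → A ∩ B ∈ ⋃ C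
    both A B G∈C G′∈C k k′ (inj₁ s) = ∈-⋃⁺ G′∈C _ (IsFilter.inter (filter _ G′∈C) (s A k) k′)
    both A B G∈C G′∈C k k′ (inj₂ s) = ∈-⋃⁺ G∈C _ (IsFilter.inter (filter _ G∈C) k (s B k′))

  module _ {X : Set} (F : Subset (Subset X)) (filter : IsFilter F) where
    open IsFilter filter

    Adjoined : (Subset X → Set) → Subset X → Set
    Adjoined 𝒜 B = ∃ λ C → ∃ λ A → C ∈ F × 𝒜 A × C ∩ A ⊆ B

    adjoin : (Subset X → Set) → Subset (Subset X)
    adjoin 𝒜 = ⟪ Adjoined 𝒜 ⟫

    -- Properness comes from the last hypothesis: if C ∩ A were empty, the complement of A would
    -- contain C and so lie in `F`.
    adjoin-isFilter : (𝒜 : Subset X → Set) → 𝒜 (λ _ → true) →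
      (∀ {A B} → 𝒜 A → 𝒜 B → 𝒜 (A ∩ B)) →
      (∀ {A} → 𝒜 A → ¬ ∁ A ∈ F) → IsFilter (adjoin 𝒜)
    adjoin-isFilter 𝒜 full′ inter′ meets = record
      { full   = ∈-⟪⟫⁺ (Adjoined 𝒜) (_ , _ , full , full′ , λ _ _ → tt)
      ; proper = λ h → let (C , A , C∈F , a , s) = ∈-⟪⟫⁻ (Adjoined 𝒜) h in
          meets a (upward C∈F λ x c → ∈-∁⁺ {A = A} λ k → s x (∈-∩⁺ C A x c k))
      ; upward = λ h B⊆B′ → let (C , A , C∈F , a , s) = ∈-⟪⟫⁻ (Adjoined 𝒜) h in
          ∈-⟪⟫⁺ (Adjoined 𝒜) (C , A , C∈F , a , λ x → B⊆B′ x ∘ s x)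
      ; inter  = λ {B} {B′} h h′ →
          let (C , A , C∈F , a , s) = ∈-⟪⟫⁻ (Adjoined 𝒜) h
              (C′ , A′ , C′∈F , a′ , s′) = ∈-⟪⟫⁻ (Adjoined 𝒜) h′ in
          ∈-⟪⟫⁺ (Adjoined 𝒜) (C ∩ C′ , A ∩ A′ , inter C∈F C′∈F , inter′ a a′ , λ x k →
            let (c , k₂) = ∈-∩⁻ (C ∩ C′) (A ∩ A′) x k
                (c₁ , c₂) = ∈-∩⁻ C C′ x c
                (a₁ , a₂) = ∈-∩⁻ A A′ x k₂
            in ∈-∩⁺ B B′ x (s x (∈-∩⁺ C A x c₁ a₁)) (s′ x (∈-∩⁺ C′ A′ x c₂ a₂)))
      }

    ⊆-adjoin : (𝒜 : Subset X → Set) → 𝒜 (λ _ → true) → F ⊆ adjoin 𝒜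
    ⊆-adjoin 𝒜 full′ B B∈F = ∈-⟪⟫⁺ (Adjoined 𝒜) (B , _ , B∈F , full′ , λ x k → proj₁ (∈-∩⁻ B (λ _ → true) x k))

    ∈-adjoin : (𝒜 : Subset X → Set) → ∀ {A} → 𝒜 A → A ∈ adjoin 𝒜
    ∈-adjoin 𝒜 {A} a = ∈-⟪⟫⁺ (Adjoined 𝒜) (_ , A , full , a , λ _ k → k)

  -- To a maximal filter, a set whose complement is missing can be adjoined, so it is already there.
  ultrafilter-above : ∀ {X} (F : Subset (Subset X)) → IsFilter F → ∃ λ (p : Ultrafilter X) → F ⊆ sets p
  ultrafilter-above {X} F filter with maximal isFilter-chainClosed F filter
  ... | U , F⊆U , filterU , max = record
      { sets = U ; full = full ; proper = proper ; upward = λ _ _ a s → upward a s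
      ; inter = λ _ _ → inter ; ultra = ultra }
    , F⊆U
    where
    open IsFilter filterU
    ultra : ∀ A → A ∈ U ⊎ ∁ A ∈ U
    ultra A with em {∁ A ∈ U}
    ... | yes h = inj₂ h
    ... | no ¬h = inj₁ (max _ (adjoin-isFilter U filterU (A ⊆_) (λ _ _ → tt)
        (λ {B} {C} s t x k → ∈-∩⁺ B C x (s x k) (t x k))
        λ {B} s k → ¬h (upward k λ x l → ∈-∁⁺ {A = A} {x} (∈-∁⁻ {A = B} {x} l ∘ s x)))
      (⊆-adjoin U filterU _ (λ _ _ → tt)) A (∈-adjoin U filterU (A ⊆_) (λ _ → id)))

  -- Idempotent ultrafilters

  isIdempotentFilter-chainClosed : ChainClosed IsIdempotentFilter
  isIdempotentFilter-chainClosed .ChainClosed.union C c filter chain = record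
    { isFilter   = union
    ; idempotent = λ h → let (F , F∈C , A∈F) = ∈-⋃⁻ h in
        IsFilter.upward union (∈-⋃⁺ F∈C _ (IsIdempotentFilter.idempotent (filter F F∈C) A∈F))
          λ x → ∈-⋃⁺ F∈C _
    }
    where
    union : IsFilter (⋃ C)
    union = ChainClosed.union isFilter-chainClosed C c (λ F → IsIdempotentFilter.isFilter ∘ filter F) chain

  -- For p ⊇ F, a maximal idempotent filter F equals F + p, and then it also
  -- absorbs the sets { x : -x + A ∈ p } with A ∈ p, whence p + p = p.
  idempotent-above : ∀ F₀ → IsIdempotentFilter F₀ →
    ∃ λ (p : Ultrafilter ℕ⁺) → F₀ ⊆ sets p × Idempotent p
  idempotent-above F₀ F₀-filter with maximal isIdempotentFilter-chainClosed F₀ F₀-filter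
  ... | F , F₀⊆F , F-filter , F-max with ultrafilter-above F (IsIdempotentFilter.isFilter F-filter)
  ... | p , F⊆p = p , (λ A → F⊆p A ∘ F₀⊆F A) , λ A → mk⇔ (p⊕p⊆p A) (p⊆p⊕p A)
    where
    open IsIdempotentFilter F-filter
    module P = IsFilter (ultrafilter-isFilter p)

    -- The filter of the closed set S + p, where S is the set of ultrafilters above `F`; maximality
    -- will give S + p = S.
    F⊕p : Subset (Subset ℕ⁺)
    F⊕p A = F (λ x → sets p (translate x A))

    F⊆F⊕p : F ⊆ F⊕p
    F⊆F⊕p A A∈F = upward (idempotent A∈F) λ x → F⊆p _

    F⊕p-upward : ∀ {A B} → A ∈ F⊕p → A ⊆ B → B ∈ F⊕p
    F⊕p-upward a s = upward a λ x h → P.upward h λ y → s _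

    F⊕p-isIdempotentFilter : IsIdempotentFilter F⊕p
    F⊕p-isIdempotentFilter = record
      { isFilter = record
        { full   = upward full λ _ _ → P.full
        ; proper = λ h → proper (upward h λ _ → ⊥-elim ∘ P.proper)
        ; upward = F⊕p-upward
        ; inter  = λ {A} {B} a b → upward (inter a b) λ x h →
            let (h₁ , h₂) = ∈-∩⁻ (λ x → sets p (translate x A)) (λ x → sets p (translate x B)) x h
            in P.inter h₁ h₂
        }
      ; idempotent = λ {A} a → F⊕p-upward (F⊆F⊕p _ (idempotent a))
          λ x h → upward h λ y k → P.upward k (translate-+⁺ x y A)
      }

    F⊕p⊆F : F⊕p ⊆ F
    F⊕p⊆F = F-max F⊕p F⊕p-isIdempotentFilter F⊆F⊕p

    limit : Subset ℕ⁺ → Subset ℕ⁺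
    limit A x = sets p (translate x A)

    Limit : Subset ℕ⁺ → Set
    Limit B = ∃ λ A → A ∈ sets p × limit A ⊆ B

    limit-full : Limit (λ _ → true)
    limit-full = _ , P.full , λ _ _ → tt

    -- The filter of { q ∈ S : q + p = p }, a closed subsemigroup; by maximality it is all of S, and
    -- p is one such q.
    G : Subset (Subset ℕ⁺)
    G = adjoin F isFilter Limit

    G-isFilter : IsFilter G
    G-isFilter = adjoin-isFilter F isFilter Limit limit-full
      (λ {B} {B′} (A , a , s) (A′ , a′ , s′) → A ∩ A′ , P.inter a a′ , λ x h →
        ∈-∩⁺ B B′ x
          (s x (P.upward h λ y k → proj₁ (∈-∩⁻ A A′ (x +⁺ y) k)))
          (s′ x (P.upward h λ y k → proj₂ (∈-∩⁻ A A′ (x +⁺ y) k))))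
      -- This set is nonempty: were `∁ B` in `F`, then `∁ A` would be in F ⊕ p = F, hence in p,
      -- against A ∈ p.
      λ {B} (A , a , s) h → ∁-∉ p {A}
        (F⊆p _ (F⊕p⊆F (∁ A) (upward h λ x b → ∉-∁ p (∈-∁⁻ {A = B} b ∘ s x)))) a

    G-isIdempotentFilter : IsIdempotentFilter G
    G-isIdempotentFilter = record
      { isFilter   = G-isFilter
      ; idempotent = λ {B} b → let (C , D , c , (A , a , s) , t) = ∈-⟪⟫⁻ (Adjoined F isFilter Limit) b in
          ∈-⟪⟫⁺ (Adjoined F isFilter Limit)
            ((λ x → F (translate x C)) , limit A , idempotent c , (A , a , λ _ k → k) , λ x h →
              let (h₁ , h₂) = ∈-∩⁻ (λ x → F (translate x C)) (limit A) x h in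
              ∈-⟪⟫⁺ (Adjoined F isFilter Limit) 
                (translate x C , limit (translate x A) , h₁ , (translate x A , h₂ , λ _ k → k) , λ y k →
                let (k₁ , k₂) = ∈-∩⁻ (translate x C) (limit (translate x A)) y k in
                t (x +⁺ y) (∈-∩⁺ C D (x +⁺ y) k₁ (s _ (P.upward k₂ (translate-+⁺⁻ x y A))))))
      }

    p⊆p⊕p : sets p ⊆ sets (p ⊕ p)
    p⊆p⊕p A a = F⊆p (limit A) (F-max G G-isIdempotentFilter (⊆-adjoin F isFilter Limit limit-full)
      (limit A) (∈-adjoin F isFilter Limit (A , a , λ _ k → k)))

    p⊕p⊆p : sets (p ⊕ p) ⊆ sets p
    p⊕p⊆p A h = stable λ ¬a → ∁-∉ (p ⊕ p) {A} (p⊆p⊕p (∁ A) (∉-∁ p {A} ¬a)) h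

  -- J-sets

  fromList⁺ : ∀ {X} → List⁺ X → 𝒫f X
  fromList⁺ (x ∷⁺ xs) = mk𝒫f (_ ∷⁺ _) (deduplicate-! (λ _ _ → em) (x ∷ xs))

  ∈-fromList⁺ : ∀ {X} {x : X} xs → x ∈ₗ toList xs → x ∈f fromList⁺ xs
  ∈-fromList⁺ (x ∷⁺ xs) = ∈-deduplicate⁺ (λ _ _ → em)

  -- The J-set property is applied to the functions t ↦ f(t + n), and β is then moved up by n.
  IsJSet-beyond : ∀ {A} → IsJSet A → ∀ (F : 𝒫f (ℕ⁺ → ℕ⁺)) n →
    ∃[ a ] ∃[ β ] n < min β × ∀ f → f ∈f F → (a +⁺ ∑ β f) ∈ A
  IsJSet-beyond {A} J F n with J (fromList⁺ (List⁺.map (λ f t → f (t +₀ n)) (elements F)))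
  ... | a , β , h = a , β′ , min-greatest β′ far , λ f m →
      subst (λ s → a +⁺ s ∈ A)
        (value-injective {∑ β (λ t → f (t +₀ n))} {∑ β′ f} (trans (value-∑ β (λ t → f (t +₀ n)))
          (sym (trans (value-∑ β′ f) (cong sum (sym (mapₗ-∘ (toList (elements β)))))))))
        (h (λ t → f (t +₀ n)) (∈-fromList⁺ (List⁺.map (λ f t → f (t +₀ n)) (elements F)) (∈-map⁺ _ m)))
    where
    β′ : 𝒫f ℕ⁺
    β′ = mk𝒫f (List⁺.map (_+₀ n) (elements β))
      (Unique.map⁺ (+₀-injective _ _) (unique β))
      where
      +₀-injective : ∀ x y → x +₀ n ≡ y +₀ n → x ≡ y
      +₀-injective x y e = value-injective (+-cancelʳ-≡ n (value x) (value y) (cong value e))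
    far : ∀ x → x ∈f β′ → n < value x
    far x m with ∈-map⁻ (_+₀ n) {xs = toList (elements β)} m
    ... | pos (suc k) , _ , refl = s≤s (m≤n+m n k)

  ¬IsJSet⇒ : ∀ {A} → ¬ IsJSet A → ∃ λ F → ∀ a β → ¬ (∀ f → f ∈f F → (a +⁺ ∑ β f) ∈ A)
  ¬IsJSet⇒ ¬J = stable λ h → ¬J λ F → stable λ k → h (F , λ a β l → k (a , β , l))

  module _ {k : ℕ} (f : Fin k → ℕ⁺ → ℕ⁺) (n : ℕ) where

    -- The argument n t + j of the j-th letter, increased by one to stay positive.
    argument : ℕ → ℕ⁺ → ℕ⁺
    argument j t = pos (suc (n * value t + j))

    wordSum : ∀ {m} → ℕ → Vec (Fin k) m → ℕ⁺ → ℕ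
    wordSum j []      t = 0
    wordSum j (i ∷ w) t = value (f i (argument j t)) + wordSum (suc j) w t

    module _ (ts : List ℕ⁺) where

      constantPart : ∀ {m} → ℕ → Template (Fin k) m → ℕ
      constantPart j []            = 0
      constantPart j (nothing ∷ τ) = constantPart (suc j) τ
      constantPart j (just i ∷ τ)  = sum (map (value ∘ f i ∘ argument j) ts) + constantPart (suc j) τ

      variablePart : ∀ {m} → ℕ → Template (Fin k) m → List ℕ⁺
      variablePart j []            = []
      variablePart j (nothing ∷ τ) = map (argument j) ts ++ₗ variablePart (suc j) τ
      variablePart j (just _ ∷ τ)  = variablePart (suc j) τ

      -- Fixed letters contribute a constant free of `i`; a variable at position j contributes the
      -- values of `f i` at n t + j + 1. The arguments thus form one list that serves all `i`.
      sum-line : ∀ {m} j (τ : Template (Fin k) m) i →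
        sum (map (wordSum j (τ ⟨ i ⟩)) ts) ≡ constantPart j τ + sum (map (value ∘ f i) (variablePart j τ))
      sum-line j [] i = sum-zero ts
        where
        sum-zero : ∀ ts → sum (map (wordSum j []) ts) ≡ 0
        sum-zero []       = refl
        sum-zero (_ ∷ ts) = sum-zero ts
      sum-line j (just i′ ∷ τ) i = begin
        sum (map (wordSum j (i′ ∷ τ ⟨ i ⟩)) ts)                       ≡⟨ sum-map-+ (value ∘ f i′ ∘ argument j) _ ts ⟩
        s + sum (map (wordSum (suc j) (τ ⟨ i ⟩)) ts)                  ≡⟨ cong (s +_) (sum-line (suc j) τ i) ⟩
        s + (constantPart (suc j) τ + sum (map (value ∘ f i) (variablePart (suc j) τ))) ≡⟨ +-assoc s _ _ ⟨
        s + constantPart (suc j) τ + sum (map (value ∘ f i) (variablePart (suc j) τ))   ∎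
        where
        open ≡-Reasoning
        s = sum (map (value ∘ f i′ ∘ argument j) ts)
      sum-line j (nothing ∷ τ) i = begin
        sum (map (wordSum j (i ∷ τ ⟨ i ⟩)) ts)       ≡⟨ sum-map-+ (value ∘ f i ∘ argument j) _ ts ⟩
        s + sum (map (wordSum (suc j) (τ ⟨ i ⟩)) ts) ≡⟨ cong (s +_) (sum-line (suc j) τ i) ⟩
        s + (c + sum (map g vs))                     ≡⟨ +-assoc s c _ ⟨
        s + c + sum (map g vs)                       ≡⟨ cong (_+ sum (map g vs)) (+-comm s c) ⟩
        c + s + sum (map g vs)                       ≡⟨ +-assoc c s _ ⟩
        c + (s + sum (map g vs))                     ≡⟨ cong (λ k → c + (sum k + sum (map g vs))) (mapₗ-∘ ts) ⟩
        c + (sum (map g us) + sum (map g vs))        ≡⟨ cong (c +_) (sum-++ (map g us) _) ⟨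
        c + sum (map g us ++ₗ map g vs)              ≡⟨ cong (λ k → c + sum k) (mapₗ-++ g us _) ⟨
        c + sum (map g (us ++ₗ vs))                  ∎
        where
        open ≡-Reasoning
        g  = value ∘ f i
        us = map (argument j) ts
        vs = variablePart (suc j) τ
        s  = sum (map (g ∘ argument j) ts)
        c  = constantPart (suc j) τ

      variablePart-nonempty : ∀ {m} j (τ : Template (Fin k) m) → HasVariable τ → ∀ {t} → t ∈ₗ ts →
        ∃ λ s → s ∈ₗ variablePart j τ
      variablePart-nonempty j (nothing ∷ τ) _ t∈ts = _ , ∈-++⁺ˡ (∈-map⁺ (argument j) t∈ts)
      variablePart-nonempty j (just _ ∷ τ) (there h) t∈ts = variablePart-nonempty (suc j) τ h t∈ts

      ∈-variablePart : ∀ {m} j (τ : Template (Fin k) m) {s} → s ∈ₗ variablePart j τ →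
        ∃ λ l → ∃ λ t → j ≤ l × l < j + m × s ≡ argument l t
      ∈-variablePart {suc m} j (x ∷ τ) s∈ with split x s∈
        where
        split : ∀ x {s} → s ∈ₗ variablePart j (x ∷ τ) → s ∈ₗ map (argument j) ts ⊎ s ∈ₗ variablePart (suc j) τ
        split nothing  = ∈-++⁻ (map (argument j) ts)
        split (just _) = inj₂
      ... | inj₁ h = let (t , _ , e) = ∈-map⁻ _ h in j , t , ≤-refl , m<m+n j (s≤s z≤n) , e
      ... | inj₂ h = let (l , t , j<l , l< , e) = ∈-variablePart (suc j) τ h in
        l , t , <⇒≤ j<l , subst (l <_) (sym (+-suc j m)) l< , e

      -- Positions are below `n`, so n t + j + 1 determines j by its residue and then t. The spacing
      -- by `n` is there for this: the list has to present a set.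
      variablePart-unique : Unique ts → ∀ {m} j (τ : Template (Fin k) m) → j + m ≤ n → Unique (variablePart j τ)
      variablePart-unique u j []            h = []
      variablePart-unique u {suc m} j (just _ ∷ τ) h = variablePart-unique u (suc j) τ (subst (_≤ n) (+-suc j m) h)
      variablePart-unique u {suc m} j (nothing ∷ τ) h =
        Unique.++⁺ (Unique.map⁺ (argument-injective n≢0) u) (variablePart-unique u (suc j) τ h′) disjoint
        where
        h′ : suc j + m ≤ n
        h′ = subst (_≤ n) (+-suc j m) h
        j<n : j < n
        j<n = ≤-trans (m<m+n j (s≤s z≤n)) h
        n≢0 : NonZero n
        n≢0 = >-nonZero (≤-trans (s≤s z≤n) j<n)
        argument-injective : NonZero n → ∀ {s t} → argument j s ≡ argument j t → s ≡ t
        argument-injective n≢0 {s} {t} e = value-injective (*-cancelˡ-≡ _ _ n {{n≢0}}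
          (+-cancelʳ-≡ j _ _ (suc-injective (cong value e))))
        argument-% : .{{_ : NonZero n}} → ∀ {l} → l < n → ∀ t → (n * value t + l) % n ≡ l
        argument-% {l} l<n t = trans (cong (_% n) (trans (+-comm (n * value t) l) (cong (l +_) (*-comm n (value t)))))
          (trans ([m+kn]%n≡m%n l (value t) n) (m<n⇒m%n≡m l<n))
        disjoint : ∀ {s} → ¬ (s ∈ₗ map (argument j) ts × s ∈ₗ variablePart (suc j) τ)
        disjoint (s∈ , s∈′) with ∈-map⁻ (argument j) s∈ | ∈-variablePart (suc j) τ s∈′
        ... | t , _ , refl | l , t′ , j<l , l< , e = <-irrefl
          (trans (sym (argument-% {{n≢0}} j<n t))
            (trans (cong (λ x → _%_ x n {{n≢0}}) (suc-injective (cong value e)))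
              (argument-% {{n≢0}} (≤-trans l< h′) t′))) j<l

  allWords : ∀ k n → List (Vec (Fin k) n)
  allWords k n = map (λ i → tabulate (finToFun i)) (allFin (k ^ n))

  ∈-allWords : ∀ {k n} (w : Vec (Fin k) n) → w ∈ₗ allWords k n
  ∈-allWords {k} {n} w = subst (_∈ₗ allWords k n)
    (trans (tabulate-cong (finToFun-funToFin (lookup w))) (tabulate∘lookup w))
    (∈-map⁺ (λ i → tabulate (finToFun i)) (∈-allFin (funToFin (lookup w))))

  -- Apply the J-set property to the functions t ↦ 1 + ∑ⱼ f_{wⱼ}(n t + j + 1), one
  -- for each word w of length n over the given functions: the sums obtained
  -- along a monochromatic line have the form a + ∑_β f.
  IsJSet-lines : ∀ {A} → IsJSet A → ∀ {r} (f : Fin (suc r) → ℕ⁺ → ℕ⁺) {B C} →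
    (∀ x → x ∈ A → x ∈ B ⊎ x ∈ C) →
    ∃[ a ] ∃[ β ] ((∀ i → (a +⁺ ∑ β (f i)) ∈ B) ⊎ (∀ i → (a +⁺ ∑ β (f i)) ∈ C))
  IsJSet-lines {A} J {r} f {B} {C} cover with halesJewett em r 2
  ... | n , line with J (fromList⁺ (g (Vec.replicate n zero) ∷⁺ map g (allWords (suc r) n)))
    where
    g : Vec (Fin (suc r)) n → ℕ⁺ → ℕ⁺
    g w t = pos (suc (wordSum f n 0 w t))
  ... | a , β , h = a′ , β′ , result
    where
    g : Vec (Fin (suc r)) n → ℕ⁺ → ℕ⁺
    g w t = pos (suc (wordSum f n 0 w t))

    point : Vec (Fin (suc r)) n → ℕ⁺
    point w = a +⁺ ∑ β (g w)

    point∈A : ∀ w → point w ∈ A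
    point∈A w = h (g w) (∈-fromList⁺ _ (thereₗ (∈-map⁺ g (∈-allWords w))))

    χ : Vec (Fin (suc r)) n → Fin 2
    χ w with em {point w ∈ B}
    ... | yes _ = zero
    ... | no  _ = suc zero

    χ≡0 : ∀ w → χ w ≡ zero → point w ∈ B
    χ≡0 w e with em {point w ∈ B}
    ... | yes b = b
    χ≡0 w () | no _

    χ≡1 : ∀ w → χ w ≡ suc zero → point w ∈ C
    χ≡1 w e with em {point w ∈ B}
    χ≡1 w () | yes _
    ... | no ¬b with cover _ (point∈A w)
    ...   | inj₁ b = ⊥-elim (¬b b)
    ...   | inj₂ c = c

    τ = proj₁ (line χ)
    ts = toList (elements β)

    β-list : ∃ λ β′ → toList (elements β′) ≡ variablePart f n ts 0 τ
    β-list = 𝒫f-of-list (variablePart f n ts 0 τ)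
      (proj₂ (variablePart-nonempty f n ts 0 τ (proj₁ (proj₂ (line χ))) (hereₗ refl)))
      (variablePart-unique f n ts (unique β) 0 τ ≤-refl)

    β′ = proj₁ β-list
    -- `length ts` collects the summands 1 that keep the values of `g` positive.
    a′ = a +₀ (length ts + constantPart f n ts 0 τ)

    point-line : ∀ i → point (τ ⟨ i ⟩) ≡ a′ +⁺ ∑ β′ (f i)
    point-line i = value-injective (begin
      value a + value (∑ β (g (τ ⟨ i ⟩)))                    ≡⟨ cong (value a +_) (value-∑ β _) ⟩
      value a + sum (map (suc ∘ wordSum f n 0 (τ ⟨ i ⟩)) ts) ≡⟨ cong (value a +_) (sum-map-suc _ ts) ⟩
      value a + (m + sum (map (wordSum f n 0 (τ ⟨ i ⟩)) ts)) ≡⟨ cong (λ x → value a + (m + x)) (sum-line f n ts 0 τ i) ⟩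
      value a + (m + (c + s (variablePart f n ts 0 τ)))      ≡⟨ cong (λ x → value a + (m + (c + s x))) (proj₂ β-list) ⟨
      value a + (m + (c + s (toList (elements β′))))         ≡⟨ cong (value a +_) (+-assoc m c _) ⟨
      value a + (m + c + s (toList (elements β′)))           ≡⟨ +-assoc (value a) _ _ ⟨
      value a + (m + c) + s (toList (elements β′))           ≡⟨ cong (value a + (m + c) +_) (value-∑ β′ (f i)) ⟨
      value a + (m + c) + value (∑ β′ (f i))                 ∎)
      where
      open ≡-Reasoning
      m = length ts
      c = constantPart f n ts 0 τ
      s : List ℕ⁺ → ℕ
      s xs = sum (map (value ∘ f i) xs)

    mono : ∀ i → χ (τ ⟨ i ⟩) ≡ χ (τ ⟨ zero ⟩)
    mono i = proj₂ (proj₂ (line χ)) i zero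

    result : (∀ i → (a′ +⁺ ∑ β′ (f i)) ∈ B) ⊎ (∀ i → (a′ +⁺ ∑ β′ (f i)) ∈ C)
    result with χ (τ ⟨ zero ⟩) in eq
    ... | zero     = inj₁ λ i → subst (_∈ B) (point-line i) (χ≡0 _ (trans (mono i) eq))
    ... | suc zero = inj₂ λ i → subst (_∈ C) (point-line i) (χ≡1 _ (trans (mono i) eq))

  covered : ∀ a β A {f} {fs : List (ℕ⁺ → ℕ⁺)} →
    (∀ i → (a +⁺ ∑ β (List.lookup fs i)) ∈ A) → f ∈ₗ fs → (a +⁺ ∑ β f) ∈ A
  covered a β A h m = subst (λ f → (a +⁺ ∑ β f) ∈ A) (sym (lookup-index m)) (h (index m))

  -- A family refuting B and a family refuting C are joined into one; a monochromatic line over the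
  -- joint family contradicts one of the two.
  IsJSet-partition : ∀ A B C → IsJSet A → (∀ x → x ∈ A → x ∈ B ⊎ x ∈ C) → ¬ IsJSet B → ¬ IsJSet C → ⊥
  IsJSet-partition A B C J cover ¬B ¬C = refute (¬IsJSet⇒ {B} ¬B) (¬IsJSet⇒ {C} ¬C)
    where
    refute : (∃ λ F → ∀ a β → ¬ (∀ f → f ∈f F → (a +⁺ ∑ β f) ∈ B)) →
             (∃ λ F → ∀ a β → ¬ (∀ f → f ∈f F → (a +⁺ ∑ β f) ∈ C)) → ⊥
    refute (mk𝒫f (b ∷⁺ bs) _ , hB) (mk𝒫f (c ∷⁺ cs) _ , hC) =
      conclude (IsJSet-lines J (List.lookup (b ∷ bs ++ₗ c ∷ cs)) {B} {C} cover)
      where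
      conclude : ¬ (∃[ a ] ∃[ β ] ((∀ i → (a +⁺ ∑ β (List.lookup (b ∷ bs ++ₗ c ∷ cs) i)) ∈ B)
                                 ⊎ (∀ i → (a +⁺ ∑ β (List.lookup (b ∷ bs ++ₗ c ∷ cs) i)) ∈ C)))
      conclude (a , β , inj₁ h) = hB a β λ f m → covered a β B h (∈-++⁺ˡ m)
      conclude (a , β , inj₂ h) = hC a β λ f m → covered a β C h (∈-++⁺ʳ (b ∷ bs) m)

  -- From chains to idempotents

  -- Membership is one string of quantifiers "for p-most x", whether split at its first or at its
  -- last quantifier. `⨂` splits off the last one, the inductions on chains the first.
  Prod-∷ʳ : ∀ m (p : Fin (suc m) → Ultrafilter ℕ⁺) A → sets (Prod (suc m) p) A ≡
    sets (Prod m (p ∘ inject₁)) (λ xs → sets (p (fromℕ m)) (λ y → A (xs ∷ʳ y)))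
  Prod-∷ʳ zero    p A = refl
  Prod-∷ʳ (suc m) p A = cong (sets (p zero)) (ext λ x → Prod-∷ʳ m (p ∘ suc) (A ∘ (x ∷_)))

  ⨂≡Prod : ∀ k p A → sets (⨂ k p) A ≡ sets (Prod (suc k) p) A
  ⨂≡Prod zero    p A = refl
  ⨂≡Prod (suc k) p A = trans (⨂≡Prod k (p ∘ inject₁) _) (sym (Prod-∷ʳ (suc k) p A))

  one : ℕ⁺
  one = pos 1

  fresh : ∀ fs → ∃ λ (g : ℕ⁺ → ℕ⁺) → ¬ g ∈ₗ fs
  fresh fs = (λ _ → one +₀ sum (map size fs)) , λ m → <-irrefl refl (∈⇒≤sum m)
    where
    size : (ℕ⁺ → ℕ⁺) → ℕ
    size f = value (f one)
    ∈⇒≤sum : ∀ {g fs} → g ∈ₗ fs → size g ≤ sum (map size fs)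
    ∈⇒≤sum (hereₗ refl) = m≤m+n _ _
    ∈⇒≤sum (thereₗ m)   = ≤-trans (∈⇒≤sum m) (m≤n+m _ _)

  -- The union together with a fresh function, so that chains can always be continued upwards.
  strictly-above : (Fs : List Functions) → ∃ λ K → All (_⊊ K) Fs
  strictly-above Fs = K , All.tabulate λ {F} F∈Fs →
      (λ f∈F → ∈-fromList⁺ (g ∷⁺ fs) (thereₗ (⊆fs F∈Fs f∈F)))
    , λ (_ , K⊆F) → g∉fs (⊆fs F∈Fs (K⊆F (∈-fromList⁺ (g ∷⁺ fs) (hereₗ refl))))
    where
    fs = concatMap (toList ∘ elements) Fs
    g = proj₁ (fresh fs)
    g∉fs = proj₂ (fresh fs)
    K = fromList⁺ (g ∷⁺ fs)
    ⊆fs : ∀ {F f} → F ∈ₗ Fs → f ∈f F → f ∈ₗ fs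
    ⊆fs {f = f} F∈Fs f∈F = ∈-concatMap⁺ (toList ∘ elements) (ListAny.map (λ { refl → f∈F }) F∈Fs)

  module _ (α : Functions → ℕ⁺) (H : Functions → 𝒫f ℕ⁺) where

    TotalAbove : Functions → ℕ⁺ → Set
    TotalAbove F x = ∃ λ l → Increasing (toList l) × All (F ≺_) (toList l) × x ≡ total (term α H) l

    totalsAbove : Functions → Subset ℕ⁺
    totalsAbove F = ⟪ TotalAbove F ⟫

    totalsAbove-antitone : ∀ F K → F ⊊ K → totalsAbove K ⊆ totalsAbove F
    totalsAbove-antitone F K F⊊K x x∈ = let (l , inc , above , e) = ∈-⟪⟫⁻ (TotalAbove K) x∈ in
      ∈-⟪⟫⁺ (TotalAbove F) (l , inc , ≺-lower F K F⊊K above , e)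

    -- With K above all sets of the chain behind x, any chain above K can be put after that chain,
    -- and the sums add.
    totalsAbove-+⁺ : ∀ {F x} → x ∈ totalsAbove F → ∃ λ K → totalsAbove K ⊆ translate x (totalsAbove F)
    totalsAbove-+⁺ {F} {x} x∈ with ∈-⟪⟫⁻ (TotalAbove F) x∈
    ... | l , inc , above , refl = K , λ y y∈ → let (l′ , inc′ , above′ , e) = ∈-⟪⟫⁻ (TotalAbove K) y∈ in
        ∈-⟪⟫⁺ (TotalAbove F) (l ⁺++⁺ l′
          , AllPairs.++⁺ inc inc′ (All.map (λ {e} e⊊K → ≺-lower (proj₁ e) K e⊊K above′) l⊊K)
          , All.++⁺ above (≺-lower F K (⊊-trans F (proj₁ (List⁺.head l)) K (All.head above) (All.head l⊊K)) above′)
          , trans (cong (x +⁺_) e) (sym (total-++ (term α H) l l′)))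
      where
      K = proj₁ (strictly-above (map proj₁ (toList l)))
      l⊊K : All (λ e → proj₁ e ⊊ K) (toList l)
      l⊊K = All.map⁻ (proj₂ (strictly-above (map proj₁ (toList l))))

    -- One-step chains suffice: if K is above F and contains the test family, every f of that family
    -- may be paired with K, and α(K), H(K) do not depend on f.
    totalsAbove-IsJSet : ∀ F → IsJSet (totalsAbove F)
    totalsAbove-IsJSet F F′ with strictly-above (F ∷ F′ ∷ [])
    ... | K , F⊊K ∷ F′⊊K ∷ [] = α K , H K , λ f f∈F′ →
      ∈-⟪⟫⁺ (TotalAbove F) ((K , f , proj₁ F′⊊K f∈F′) ∷⁺ [] , [] ∷ [] , F⊊K ∷ [] , refl)

    Large : Subset ℕ⁺ → Set
    Large A = ∃ λ F → ¬ IsJSet (totalsAbove F ∩ ∁ A)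

    large : Subset (Subset ℕ⁺)
    large = ⟪ Large ⟫

    ∅-¬IsJSet : ∀ A → (∀ x → ¬ x ∈ A) → ¬ IsJSet A
    ∅-¬IsJSet A h J = let (_ , _ , k) = J (fromList⁺ (id ∷⁺ [])) in h _ (k id (∈-fromList⁺ (id ∷⁺ []) (hereₗ refl)))

    totalsAbove-large : ∀ F → totalsAbove F ∈ large
    totalsAbove-large F = ∈-⟪⟫⁺ Large (F , ∅-¬IsJSet (totalsAbove F ∩ ∁ (totalsAbove F)) λ x h →
      let (a , b) = ∈-∩⁻ (totalsAbove F) (∁ (totalsAbove F)) x h in ∈-∁⁻ {A = totalsAbove F} {x} b a)

    large-upward : ∀ {A B} → A ∈ large → A ⊆ B → B ∈ large
    large-upward {A} {B} a A⊆B = let (F , ¬J) = ∈-⟪⟫⁻ Large a in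
      ∈-⟪⟫⁺ Large (F , λ J → ¬J (IsJSet-⊆ (totalsAbove F ∩ ∁ B) (totalsAbove F ∩ ∁ A) J λ x h →
        let (h₁ , h₂) = ∈-∩⁻ (totalsAbove F) (∁ B) x h in
        ∈-∩⁺ (totalsAbove F) (∁ A) x h₁ (∈-∁⁺ {A = A} {x} (∈-∁⁻ {A = B} {x} h₂ ∘ A⊆B x))))

    large-inter : ∀ {A B} → A ∈ large → B ∈ large → A ∩ B ∈ large
    large-inter {A} {B} a b = combine (∈-⟪⟫⁻ Large a) (∈-⟪⟫⁻ Large b)
      where
      combine : Large A → Large B → A ∩ B ∈ large
      combine (F , ¬J) (F′ , ¬J′) with strictly-above (F ∷ F′ ∷ [])
      ... | K , F⊊K ∷ F′⊊K ∷ [] = ∈-⟪⟫⁺ Large (K , λ J →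
        IsJSet-partition (totalsAbove K ∩ ∁ (A ∩ B)) (totalsAbove F ∩ ∁ A) (totalsAbove F′ ∩ ∁ B) J cover ¬J ¬J′)
        where
        cover : ∀ x → x ∈ totalsAbove K ∩ ∁ (A ∩ B) →
          x ∈ totalsAbove F ∩ ∁ A ⊎ x ∈ totalsAbove F′ ∩ ∁ B
        cover x h with ∈-∩⁻ (totalsAbove K) (∁ (A ∩ B)) x h
        ... | x∈K , x∉A∩B with em {x ∈ A}
        ...   | no x∉A = inj₁ (∈-∩⁺ (totalsAbove F) (∁ A) x (totalsAbove-antitone F K F⊊K x x∈K) (∈-∁⁺ {A = A} {x} x∉A))
        ...   | yes x∈A = inj₂ (∈-∩⁺ (totalsAbove F′) (∁ B) x (totalsAbove-antitone F′ K F′⊊K x x∈K)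
            (∈-∁⁺ {A = B} {x} λ x∈B → ∈-∁⁻ {A = A ∩ B} {x} x∉A∩B (∈-∩⁺ A B x x∈A x∈B)))

    large-isIdempotentFilter : IsIdempotentFilter large
    large-isIdempotentFilter = record
      { isFilter = record
        { full   = large-upward (totalsAbove-large (fromList⁺ (id ∷⁺ []))) λ _ _ → tt
        ; proper = λ h → let (F , ¬J) = ∈-⟪⟫⁻ Large h in
            ¬J (IsJSet-⊆ (totalsAbove F) (totalsAbove F ∩ λ _ → true) (totalsAbove-IsJSet F)
              λ x k → ∈-∩⁺ (totalsAbove F) (λ _ → true) x k tt)
        ; upward = large-upward
        ; inter  = large-inter
        }
      -- For x in T(F) and T(K) inside -x + T(F), the set T(K) minus (-x + A) lies in -x + (T(F)
      -- minus A); a J-set there would make T(F) minus A a J-set.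
      ; idempotent = λ {A} a → let (F , ¬J) = ∈-⟪⟫⁻ Large a in
          large-upward (totalsAbove-large F) λ x x∈F →
            let (K , K⊆) = totalsAbove-+⁺ {F} {x} x∈F in
            ∈-⟪⟫⁺ Large (K , λ J → ¬J (IsJSet-translate x (totalsAbove F ∩ ∁ A)
              (IsJSet-⊆ (totalsAbove K ∩ ∁ (translate x A)) (translate x (totalsAbove F ∩ ∁ A)) J λ y h →
              let (h₁ , h₂) = ∈-∩⁻ (totalsAbove K) (∁ (translate x A)) y h in
              ∈-∩⁺ (totalsAbove F) (∁ A) (x +⁺ y) (K⊆ y h₁) h₂)))
      }

    -- p lies in 𝒥 because the complement of a set that is not a J-set is in `large`.
    idempotent-totals : ∃ λ p → 𝒥 p × Idempotent p × ∀ F → totalsAbove F ∈ sets p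
    idempotent-totals = let (p , large⊆p , idem) = idempotent-above large large-isIdempotentFilter in
      p , (λ A A∈p → stable λ ¬J → ∁-∉ p {A} (large⊆p (∁ A) (∈-⟪⟫⁺ Large (fromList⁺ (id ∷⁺ []) ,
            λ J → ¬J (IsJSet-⊆ (totalsAbove (fromList⁺ (id ∷⁺ [])) ∩ ∁ (∁ A)) A J λ x h →
              stable λ x∉A → ∈-∁⁻ {A = ∁ A} {x}
              (proj₂ (∈-∩⁻ (totalsAbove (fromList⁺ (id ∷⁺ []))) (∁ (∁ A)) x h)) (∈-∁⁺ {A = A} {x} x∉A))))) A∈p)
        , idem , λ F → large⊆p _ (totalsAbove-large F)

  -- Almost every first coordinate is the total of a chain above F, and the remaining chains are
  -- then taken above a K beyond it. This is why F is arbitrary.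
  totals∈⇒∈Prod : ∀ {m} (α : Fin m → Functions → ℕ⁺) (H : Fin m → Functions → 𝒫f ℕ⁺)
    (p : Fin m → Ultrafilter ℕ⁺) → (∀ i F → totalsAbove (α i) (H i) F ∈ sets (p i)) →
    ∀ F A → (∀ ls → Increasing (concatAll ls) → All (F ≺_) (concatAll ls) →
      totals (λ i → term (α i) (H i)) ls ∈ A) →
    A ∈ sets (Prod m p)
  totals∈⇒∈Prod {zero}  α H p T∈p F A h = h [] [] []
  totals∈⇒∈Prod {suc m} α H p T∈p F A h = Ultrafilter.upward (p zero) _ _ (T∈p zero F)
    λ x → step x ∘ ∈-⟪⟫⁻ (TotalAbove (α zero) (H zero) F)
    where
    step : ∀ x → TotalAbove (α zero) (H zero) F x → (A ∘ (x ∷_)) ∈ sets (Prod m (p ∘ suc))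
    step _ (l , inc , above , refl) = totals∈⇒∈Prod (α ∘ suc) (H ∘ suc) (p ∘ suc) (T∈p ∘ suc) K _
      λ ls inc′ above′ → h (l ∷ ls)
        (AllPairs.++⁺ inc inc′ (All.map (λ {e} e⊊K → ≺-lower (proj₁ e) K e⊊K above′) l⊊K))
        (All.++⁺ above (≺-lower F K (⊊-trans F (proj₁ (List⁺.head l)) K (All.head above) (All.head l⊊K)) above′))
      where
      K = proj₁ (strictly-above (map proj₁ (toList l)))
      l⊊K : All (λ e → proj₁ e ⊊ K) (toList l)
      l⊊K = All.map⁻ (proj₂ (strictly-above (map proj₁ (toList l))))

  -- The combinatorial part (b) of statement (1).
  Realizes : ∀ k → Subset (Vec ℕ⁺ (suc k)) →
    (Fin (suc k) → Functions → ℕ⁺) → (Fin (suc k) → Functions → 𝒫f ℕ⁺) → Set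
  Realizes k A α H = (n : ℕ) → suc k ≤ n →
    (G : ℕ⁺ → Functions) →
    (∀ i j → value i < value j → value j ≤ n → G i ⊊ G j) →
    (β : Fin (suc k) → 𝒫f ℕ⁺) →
    (∀ i j → i Fin.< j → β i <f β j) →
    max (β (fromℕ k)) ≤ n →
    (f : ℕ⁺ → ℕ⁺ → ℕ⁺) →
    (∀ i → value i ≤ n → f i ∈f G i) →
    tabulate (λ j → ∑ (β j) (λ i → α j (G i) +⁺ ∑ (H j (G i)) (f i))) ∈ A

  -- The concatenated chains serve as G₁ ⊊ ⋯ ⊊ Gₙ, and βⱼ is the interval of positions taken by the
  -- j-th chain.
  realizes⇒totals∈ : ∀ {k A α H} → Realizes k A α H → ∀ ls → Increasing (concatAll ls) →
    totals (λ i → term (α i) (H i)) ls ∈ A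
  realizes⇒totals∈ {k} {A} {α} {H} realizes ls@(l ∷ _) inc =
    subst (_∈ A) (totals-blocks (λ i → term (α i) (H i)) E 0 ls (agrees-at E 0 L λ s → refl))
      (realizes (length L) (length-concatAll ls) (λ i → proj₁ (E (pred (value i))))
        (λ { (pos (suc i)) (pos (suc j)) (s≤s i<j) j<n → at-Increasing inc i<j j<n })
        (blocks 0 ls) (blocks-increasing 0 ls)
        (max-least (blocks 0 ls (fromℕ k)) λ x → proj₂ ∘ ∈-blocks 0 ls (fromℕ k))
        (λ i → proj₁ (proj₂ (E (pred (value i))))) (λ i _ → proj₂ (proj₂ (E (pred (value i))))))
    where
    L = concatAll ls
    E = at (List⁺.head l) L

  realizes⇒idempotents : ∀ {k A α H} → Realizes k A α H →
    ∃ λ p → (∀ i → 𝒥 (p i) × Idempotent (p i)) × A ∈ sets (⨂ k p)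
  realizes⇒idempotents {k} {A} {α} {H} realizes = p
    , (λ i → let (_ , J , idem , _) = choice i in J , idem)
    , subst T (sym (⨂≡Prod k p A)) (totals∈⇒∈Prod α H p (λ i → proj₂ (proj₂ (proj₂ (choice i))))
        (fromList⁺ (id ∷⁺ [])) A λ ls inc _ → realizes⇒totals∈ {A = A} {α} {H} realizes ls inc)
    where
    choice = λ i → idempotent-totals (α i) (H i)
    p = λ i → proj₁ (choice i)

  -- From idempotents to chains

  filter∈powerlist : ∀ {X : Set} (P : X → Set) xs → filter (λ x → em {P x}) xs ∈ₗ powerlist xs
  filter∈powerlist P []       = hereₗ refl
  filter∈powerlist P (x ∷ xs) with em {P x}
  ... | yes _ = ∈-++⁺ˡ (∈-map⁺ (x ∷_) (filter∈powerlist P xs))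
  ... | no  _ = ∈-++⁺ʳ (map (x ∷_) (powerlist xs)) (filter∈powerlist P xs)

  size : Functions → ℕ
  size F = length (toList (elements F))

  ⊊⇒size< : ∀ F G → F ⊊ G → size F < size G
  ⊊⇒size< F G (F⊆G , F≉G) = from-witness (stable λ h → F≉G (F⊆G , λ {x} x∈G → stable λ x∉F → h (x , x∈G , x∉F)))
    where
    from-witness : (∃ λ x → x ∈f G × ¬ x ∈f F) → size F < size G
    from-witness (x , x∈G , x∉F) = unique-⊆⇒length≤
      (All.tabulate (λ { m refl → x∉F m }) ∷ unique F) λ { (hereₗ refl) → x∈G ; (thereₗ m) → F⊆G m }

  listSet : List (ℕ⁺ → ℕ⁺) → Subset (ℕ⁺ → ℕ⁺)
  listSet fs = ⟪ _∈ₗ fs ⟫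

  asSet : Functions → Subset (ℕ⁺ → ℕ⁺)
  asSet F = listSet (toList (elements F))

  represent : Subset (ℕ⁺ → ℕ⁺) → Functions
  represent S with em {∃ λ F → asSet F ≡ S}
  ... | yes (F , _) = F
  -- A default for sets without presentation, such as that of the empty sublist in `subsets`, where
  -- only proper subsets survive the filter.
  ... | no  _       = fromList⁺ (id ∷⁺ [])

  -- A representative of the ≈-class of F that depends on the class only.
  canon : Functions → Functions
  canon F = represent (asSet F)

  asSet-canon : ∀ F → asSet (canon F) ≡ asSet F
  asSet-canon F with em {∃ λ G → asSet G ≡ asSet F}
  ... | yes (_ , e) = e
  ... | no  ¬e      = ⊥-elim (¬e (F , refl))

  asSet-≡⇒⊆f : ∀ F G → asSet F ≡ asSet G → F ⊆f G
  asSet-≡⇒⊆f F G e {f} f∈F = ∈-⟪⟫⁻ (_∈f G) (subst (f ∈_) e (∈-⟪⟫⁺ (_∈f F) f∈F))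

  canon-⊆ : ∀ F → canon F ⊆f F
  canon-⊆ F = asSet-≡⇒⊆f (canon F) F (asSet-canon F)

  ⊆-canon : ∀ F → F ⊆f canon F
  ⊆-canon F = asSet-≡⇒⊆f F (canon F) (sym (asSet-canon F))

  canon-cong : ∀ F G → F ≈ G → canon F ≡ canon G
  canon-cong F G (F⊆G , G⊆F) = cong represent (⊆-antisym
    (λ f m → ∈-⟪⟫⁺ (_∈f G) (F⊆G (∈-⟪⟫⁻ (_∈f F) m))) λ f m → ∈-⟪⟫⁺ (_∈f F) (G⊆F (∈-⟪⟫⁻ (_∈f G) m)))

  ⊊-canonʳ : ∀ F G → F ⊊ G → F ⊊ canon G
  ⊊-canonʳ F G (F⊆G , F≉G) = (λ m → ⊆-canon G (F⊆G m)) , λ (_ , h) → F≉G (F⊆G , λ m → h (⊆-canon G m))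

  ⊊-canonˡ : ∀ F G → F ⊊ G → canon F ⊊ G
  ⊊-canonˡ F G (F⊆G , F≉G) = (λ m → F⊆G (canon-⊆ F m)) , λ (_ , h) → F≉G (F⊆G , λ m → canon-⊆ F (h m))

  subsets : Functions → List Functions
  subsets F = filter (λ G → em {G ⊊ F}) (map (represent ∘ listSet) (powerlist (toList (elements F))))

  ∈-subsets⁻ : ∀ {F G} → G ∈ₗ subsets F → G ⊊ F
  ∈-subsets⁻ {F} m = proj₂ (∈-filter⁻ (λ G → em {G ⊊ F})
    {xs = map (represent ∘ listSet) (powerlist (toList (elements F)))} m)

  -- The sublist of F formed by the members of G presents the same set as G, and `represent` sees
  -- only the set.
  canon∈subsets : ∀ F G → G ⊊ F → canon G ∈ₗ subsets F
  canon∈subsets F G G⊊F = ∈-filter⁺ (λ G → em {G ⊊ F})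
    (subst (_∈ₗ map (represent ∘ listSet) (powerlist fs)) (cong represent same)
      (∈-map⁺ (represent ∘ listSet) (filter∈powerlist (_∈f G) fs)))
    (⊊-canonˡ G F G⊊F)
    where
    fs = toList (elements F)
    same : listSet (filter (λ f → em {f ∈f G}) fs) ≡ asSet G
    same = ⊆-antisym
      (λ f m → ∈-⟪⟫⁺ (_∈f G) (proj₂ (∈-filter⁻ (λ f → em {f ∈f G}) {xs = fs} (∈-⟪⟫⁻ _ m))))
      λ f m → ∈-⟪⟫⁺ _ (∈-filter⁺ (λ f → em {f ∈f G}) (proj₁ G⊊F (∈-⟪⟫⁻ (_∈f G) m)) (∈-⟪⟫⁻ (_∈f G) m))

  -- The recursive choice for one coordinate

  module _ (p : Ultrafilter ℕ⁺) (p∈𝒥 : 𝒥 p) (idem : Idempotent p)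
           (R : Functions → Subset ℕ⁺) (R∈p : ∀ F → R F ∈ sets p) where

    star : Subset ℕ⁺ → Subset ℕ⁺
    star A = A ∩ λ x → sets p (translate x A)

    star-∈ : ∀ A → A ∈ sets p → star A ∈ sets p
    star-∈ A A∈p = Ultrafilter.inter p _ _ A∈p (Equivalence.from (idem A) A∈p)

    star-⊆ : ∀ A → star A ⊆ A
    star-⊆ A x h = proj₁ (∈-∩⁻ A (λ x → sets p (translate x A)) x h)

    -- -x + A is in p, hence so is its `star`, and this is contained in -x + `star A`.
    translate-star-∈ : ∀ A x → x ∈ star A → translate x (star A) ∈ sets p
    translate-star-∈ A x h = Ultrafilter.upward p _ _
      (star-∈ (translate x A) (proj₂ (∈-∩⁻ A (λ x → sets p (translate x A)) x h))) λ y k →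
      let (k₁ , k₂) = ∈-∩⁻ (translate x A) (λ y → sets p (translate y (translate x A))) y k in
      ∈-∩⁺ A (λ x → sets p (translate x A)) (x +⁺ y) k₁ (Ultrafilter.upward p _ _ k₂ (translate-+⁺⁻ x y A))

    pastTotals : List Choice → List (Functions × ℕ⁺)
    pastTotals = concatMap history

    -- A term at F either starts a chain with bottom F or goes on top of an earlier chain, which
    -- keeps the requirement of its own bottom.
    Extends : Functions → List Choice → ℕ⁺ × 𝒫f ℕ⁺ → Set
    Extends F cs (a , β) = (∀ c → c ∈ₗ cs → max (support c) < min β)
      × ∀ f → f ∈f F → a +⁺ ∑ β f ∈ star (R F)
          × ∀ h → h ∈ₗ pastTotals cs → a +⁺ ∑ β f +⁺ proj₂ h ∈ star (R (proj₁ h))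

    choose : Functions → List Choice → ℕ⁺ × 𝒫f ℕ⁺
    choose F cs with em {∃ (Extends F cs)}
    ... | yes (c , _) = c
    ... | no  _       = one , mk𝒫f (one ∷⁺ []) ([] ∷ [])

    choose-extends : ∀ {F cs} → ∃ (Extends F cs) → Extends F cs (choose F cs)
    choose-extends {F} {cs} e with em {∃ (Extends F cs)}
    ... | yes (_ , h) = h
    ... | no  ¬e      = ⊥-elim (¬e e)

    appendTerm : ℕ⁺ × 𝒫f ℕ⁺ → Functions → List Choice → (ℕ⁺ → ℕ⁺) → List (Functions × ℕ⁺)
    appendTerm (a , β) F cs f = (F , a +⁺ ∑ β f) ∷ map (λ (G , y) → G , a +⁺ ∑ β f +⁺ y) (pastTotals cs)

    step : Functions → List Choice → Choice
    step F cs = record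
      { shift   = proj₁ (choose F cs)
      ; support = proj₂ (choose F cs)
      ; history = concatMap (appendTerm (choose F cs) F cs) (toList (elements F))
      }

    -- Recursion along ⊊ with fuel n.
    choices : ℕ → Functions → Choice
    choices zero    F = step F []
    choices (suc n) F = step F (map (choices n) (subsets F))

    -- Proper subsets are smaller, so fuel `size F` lasts down to the minimal sets, where it is
    -- still positive because sets are nonempty. This yields the fuel-free equation `choice-step`.
    choices-stable : ∀ n m F → size F ≤ n → size F ≤ m → choices n F ≡ choices m F
    choices-stable (suc n) (suc m) F F≤n F≤m = cong (step F) (map-cong-local (All.tabulate λ {G} G∈ →
      let G<F = ⊊⇒size< G F (∈-subsets⁻ {F} G∈) in
      choices-stable n m G (≤-pred (≤-trans G<F F≤n)) (≤-pred (≤-trans G<F F≤m))))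

    choice : Functions → Choice
    choice F = choices (size F) F

    earlier : Functions → List Choice
    earlier F = map choice (subsets F)

    choice-step : ∀ F → choice F ≡ step F (earlier F)
    choice-step F = cong (step F) (map-cong-local (All.tabulate λ {G} G∈ →
      choices-stable _ _ G (≤-pred (⊊⇒size< G F (∈-subsets⁻ {F} G∈))) ≤-refl))

    Good : Functions × ℕ⁺ → Set
    Good (G , y) = y ∈ star (R G)

    ∈-pastTotals⁻ : ∀ {cs h} → h ∈ₗ pastTotals cs → ∃ λ c → c ∈ₗ cs × h ∈ₗ history c
    ∈-pastTotals⁻ {cs} m = find (∈-concatMap⁻ history {xs = cs} m)

    extends-exists : ∀ F cs → (∀ h → h ∈ₗ pastTotals cs → Good h) → ∃ (Extends F cs)
    extends-exists F cs good = let (a , β , far , h) = IsJSet-beyond {B} (p∈𝒥 B B∈p) F bound in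
      (a , β) , (λ c c∈ → ≤-trans (s≤s (≤-bound c∈)) far) , λ f f∈F →
        let (k₁ , k₂) = ∈-∩⁻ (star (R F)) (⋂ S (pastTotals cs)) (a +⁺ ∑ β f) (h f f∈F) in
        k₁ , λ g g∈ → subst (_∈ star (R (proj₁ g))) (+⁺-comm (proj₂ g) (a +⁺ ∑ β f)) (∈-⋂⁻ S k₂ g∈)
      where
      bound : ℕ
      bound = List.foldr (λ c → max (support c) ⊔_) 0 cs
      ≤-bound : ∀ {cs c} → c ∈ₗ cs → max (support c) ≤ List.foldr (λ c → max (support c) ⊔_) 0 cs
      ≤-bound (hereₗ refl) = m≤m⊔n _ _
      ≤-bound (thereₗ m)   = ≤-trans (≤-bound m) (m≤n⊔m _ _)
      S : Functions × ℕ⁺ → Subset ℕ⁺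
      S (G , y) = translate y (star (R G))
      B : Subset ℕ⁺
      B = star (R F) ∩ ⋂ S (pastTotals cs)
      B∈p : B ∈ sets p
      B∈p = Ultrafilter.inter p _ _ (star-∈ (R F) (R∈p F))
        (⋂-∈ p S (pastTotals cs) λ (G , y) m → translate-star-∈ (R G) y (good _ m))

    ∈-step-history⁻ : ∀ F cs {h} → h ∈ₗ history (step F cs) →
      ∃ λ f → f ∈f F × h ∈ₗ appendTerm (choose F cs) F cs f
    ∈-step-history⁻ F cs m = find (∈-concatMap⁻ (appendTerm (choose F cs) F cs) {xs = toList (elements F)} m)

    ∈-step-history⁺ : ∀ F cs {h f} → f ∈f F → h ∈ₗ appendTerm (choose F cs) F cs f →
      h ∈ₗ history (step F cs)
    ∈-step-history⁺ F cs f∈F m = ∈-concatMap⁺ (appendTerm (choose F cs) F cs) (ListAny.map (λ { refl → m }) f∈F)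

    step-good : ∀ F cs → (∀ h → h ∈ₗ pastTotals cs → Good h) → ∀ h → h ∈ₗ history (step F cs) → Good h
    step-good F cs good h m with ∈-step-history⁻ F cs m
    ... | f , f∈F , hereₗ refl = proj₁ (proj₂ (choose-extends {F} {cs} (extends-exists F cs good)) f f∈F)
    ... | f , f∈F , thereₗ k with ∈-map⁻ _ k
    ...   | g , g∈ , refl = proj₂ (proj₂ (choose-extends {F} {cs} (extends-exists F cs good)) f f∈F) g g∈

    mutual
      choices-good : ∀ n F → size F ≤ n → ∀ h → h ∈ₗ history (choice F) → Good h
      choices-good n F F≤n h m = step-good F (earlier F) (earlier-good n F F≤n) h
        (subst (λ c → h ∈ₗ history c) (choice-step F) m)

      earlier-good : ∀ n F → size F ≤ n → ∀ h → h ∈ₗ pastTotals (earlier F) → Good h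
      earlier-good (suc n) F F≤n h m with ∈-pastTotals⁻ {earlier F} m
      ... | c , c∈ , h∈ with ∈-map⁻ choice c∈
      ...   | G , G∈ , refl = choices-good n G (≤-pred (≤-trans (⊊⇒size< G F (∈-subsets⁻ {F} G∈)) F≤n)) h h∈

    choice-extends : ∀ F → Extends F (earlier F) (shift (choice F) , support (choice F))
    choice-extends F = subst (λ c → Extends F (earlier F) (shift c , support c)) (sym (choice-step F))
      (choose-extends (extends-exists F (earlier F) (earlier-good (size F) F ≤-refl)))

    choice-good : ∀ F {G y} → (G , y) ∈ₗ history (choice F) → y ∈ R G
    choice-good F {G} {y} m = star-⊆ (R G) y (choices-good (size F) F ≤-refl _ m)

    choiceTerm : Entry → ℕ⁺
    choiceTerm = term (shift ∘ choice ∘ canon) (support ∘ choice ∘ canon)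

    choice-increasing : ∀ F G → F ⊊ G → max (support (choice (canon F))) < min (support (choice (canon G)))
    choice-increasing F G F⊊G = proj₁ (choice-extends (canon G)) _
      (∈-map⁺ choice (canon∈subsets (canon G) F (⊊-canonʳ F G F⊊G)))

    -- Upwards from the bottom: the set next below the top is, up to `canon`, among the `subsets` of
    -- the top, whose step extends its history by every possible term.
    total∈history : ∀ l → Descending (toList l) →
      (canon (bottom l) , total choiceTerm l) ∈ₗ history (choice (canon (top l)))
    total∈history (e ∷⁺ es) = go e es
      where
      go : ∀ e es → Descending (e ∷ es) →
        (canon (bottom (e ∷⁺ es)) , total choiceTerm (e ∷⁺ es)) ∈ₗ history (choice (canon (proj₁ e)))
      extend-history : ∀ G {f} → f ∈f G → ∀ {h} →
        h ∈ₗ appendTerm (shift (choice (canon G)) , support (choice (canon G))) (canon G) (earlier (canon G)) f →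
        h ∈ₗ history (choice (canon G))
      extend-history G {f} f∈G {h} m = subst (λ c → h ∈ₗ history c) (sym (choice-step (canon G)))
        (∈-step-history⁺ (canon G) (earlier (canon G)) (⊆-canon G f∈G)
          (subst (λ c → h ∈ₗ appendTerm (shift c , support c) (canon G) (earlier (canon G)) f) (choice-step (canon G)) m))
      go (G , f , f∈G) [] _ = extend-history G f∈G (hereₗ refl)
      go (G , f , f∈G) (e ∷ es) ((e⊊G ∷ _) ∷ d) = extend-history G f∈G (thereₗ (∈-map⁺ _
        (∈-concatMap⁺ history (ListAny.map (λ { refl → go e es d })
          (∈-map⁺ choice (canon∈subsets (canon G) (proj₁ e) (⊊-canonʳ (proj₁ e) G e⊊G)))))))

  -- Stacking the coordinates

  Stacked : ∀ {m} → Functions → Vec (List⁺ Entry) m → Set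
  Stacked F []       = ⊤
  Stacked F (l ∷ ls) = Descending (toList l) × canon (bottom l) ≡ F × ∃ λ G → top l ⊊ G × Stacked G ls

  Respects : (Functions → ℕ⁺) → (Functions → 𝒫f ℕ⁺) → Set
  Respects α H = (∀ F G → F ≈ G → α F ≡ α G) × (∀ F G → F ≈ G → H F ≡ H G)
    × (∀ F G → F ⊊ G → max (H F) < min (H G))

  -- The induction needs requirements that vary with F: even a constant `R` leads to a varying `R′`,
  -- which takes sections at the first-coordinate sums of chains strictly below F.
  idempotents⇒stacked : ∀ {m} (p : Fin m → Ultrafilter ℕ⁺) → (∀ i → 𝒥 (p i) × Idempotent (p i)) →
    (R : Functions → Subset (Vec ℕ⁺ m)) → (∀ F → R F ∈ sets (Prod m p)) →
    ∃ λ (α : Fin m → Functions → ℕ⁺) → ∃ λ (H : Fin m → Functions → 𝒫f ℕ⁺) →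
      (∀ i → Respects (α i) (H i)) ×
      (∀ F ls → Stacked F ls → totals (λ i → term (α i) (H i)) ls ∈ R F)
  idempotents⇒stacked {zero}  p hp R R∈ = (λ ()) , (λ ()) , (λ ()) , λ { F [] _ → R∈ F }
  idempotents⇒stacked {suc m} p hp R R∈ = α , H , respects , λ { F (l ∷ ls) (d , refl , G , l⊊G , stacked) →
      ∈-⋂⁻ section (in-rest G ls stacked) (∈-concatMap⁺ (history ∘ ch)
        (ListAny.map (λ { refl → total∈history (p zero) p∈𝒥 idem R₀ R∈ l d }) (canon∈subsets G (top l) l⊊G))) }
    where
    p∈𝒥 = proj₁ (hp zero)
    idem = proj₂ (hp zero)
    R₀ : Functions → Subset ℕ⁺
    R₀ F x = sets (Prod m (p ∘ suc)) (λ xs → R F (x ∷ xs))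
    ch : Functions → Choice
    ch = choice (p zero) p∈𝒥 idem R₀ R∈
    section : Functions × ℕ⁺ → Subset (Vec ℕ⁺ m)
    section (G , y) xs = R G (y ∷ xs)
    R′ : Functions → Subset (Vec ℕ⁺ m)
    R′ F = ⋂ section (concatMap (history ∘ ch) (subsets F))
    R′∈ : ∀ F → R′ F ∈ sets (Prod m (p ∘ suc))
    R′∈ F = ⋂-∈ (Prod m (p ∘ suc)) section (concatMap (history ∘ ch) (subsets F)) λ h h∈ →
      let (G , _ , k) = find (∈-concatMap⁻ (history ∘ ch) {xs = subsets F} h∈) in
      choice-good (p zero) p∈𝒥 idem R₀ R∈ G k
    rest = idempotents⇒stacked (p ∘ suc) (hp ∘ suc) R′ R′∈
    in-rest = proj₂ (proj₂ (proj₂ rest))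
    α : Fin (suc m) → Functions → ℕ⁺
    α zero    = shift ∘ ch ∘ canon
    α (suc i) = proj₁ rest i
    H : Fin (suc m) → Functions → 𝒫f ℕ⁺
    H zero    = support ∘ ch ∘ canon
    H (suc i) = proj₁ (proj₂ rest) i
    respects : ∀ i → Respects (α i) (H i)
    respects zero    = (λ F G e → cong (shift ∘ ch) (canon-cong F G e))
      , (λ F G e → cong (support ∘ ch) (canon-cong F G e))
      , choice-increasing (p zero) p∈𝒥 idem R₀ R∈
    respects (suc i) = proj₁ (proj₂ (proj₂ rest)) i

  -- From increasing sequences to stacked chains

  module _ (n : ℕ) (G : ℕ⁺ → Functions) (G-increasing : ∀ i j → value i < value j → value j ≤ n → G i ⊊ G j)
           (f : ℕ⁺ → ℕ⁺ → ℕ⁺) (f∈G : ∀ i → value i ≤ n → f i ∈f G i) where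

    entry : ℕ⁺ → Entry
    entry i with value i ≤? n
    ... | yes i≤n = G i , f i , f∈G i i≤n
    ... | no  _   = fromList⁺ (id ∷⁺ []) , id , ∈-fromList⁺ (id ∷⁺ []) (hereₗ refl)

    entry-set : ∀ i → value i ≤ n → proj₁ (entry i) ≡ G i
    entry-set i i≤n with value i ≤? n
    ... | yes _  = refl
    ... | no i≰n = ⊥-elim (i≰n i≤n)

    entry-term : ∀ α H i → value i ≤ n → term α H (entry i) ≡ α (G i) +⁺ ∑ (H (G i)) (f i)
    entry-term α H i i≤n with value i ≤? n
    ... | yes _  = refl
    ... | no i≰n = ⊥-elim (i≰n i≤n)

    entry-⊊ : ∀ i j → value j < value i → value i ≤ n → proj₁ (entry j) ⊊ proj₁ (entry i)
    entry-⊊ i j j<i i≤n = subst₂ _⊊_ (sym (entry-set j (<⇒≤ (≤-trans j<i i≤n))))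
      (sym (entry-set i i≤n)) (G-increasing j i j<i i≤n)

    map-entry-descending : ∀ {is} → AllPairs (λ i j → value j < value i) is →
      All (λ i → value i ≤ n) is → Descending (map entry is)
    map-entry-descending []       []       = []
    map-entry-descending (h ∷ hs) (k ∷ ks) =
      All.map⁺ (All.map (λ {j} j<i → entry-⊊ _ j j<i k) h) ∷ map-entry-descending hs ks

    sorted : ∀ β → ∃ λ (is : List⁺ ℕ⁺) → toList is ≡ sort (toList (elements β))
    sorted β with sort (toList (elements β)) | sort-↭ (toList (elements β))
    ... | []     | σ = ⊥-elim (0≢1+n (↭-length σ))
    ... | i ∷ is | _ = i ∷⁺ is , refl

    -- `Q` records what lies below: in the recursive call it is `top l ⊊_`. It passes from the sets
    -- `G i` to the canonical bottom, and `∃ Q` supplies the set that `Stacked` asks for above the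
    -- last chain.
    stack : ∀ {m} (α : Fin m → Functions → ℕ⁺) (H : Fin m → Functions → 𝒫f ℕ⁺)
      (β : Fin m → 𝒫f ℕ⁺) → (∀ i j → i Fin.< j → β i <f β j) → (∀ j x → x ∈f β j → value x ≤ n) →
      (Q : Functions → Set) → ∃ Q → (∀ F → Q F → Q (canon F)) → (∀ j i → i ∈f β j → Q (G i)) →
      ∃ λ F → ∃ λ ls → Q F × Stacked F ls × totals (λ i → term (α i) (H i)) ls ≡
        tabulate (λ j → ∑ (β j) (λ i → α j (G i) +⁺ ∑ (H j (G i)) (f i)))
    stack {zero} α H β β-inc β≤n Q (F , q) Q-canon Qβ = F , [] , q , tt , refl
    stack {suc m} α H β β-inc β≤n Q ∃Q Q-canon Qβ =
      canon (bottom l) , l ∷ proj₁ (proj₂ rest)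
      , Q-canon _ (bottom-All {Q} l (All.map⁺ (All.map (λ {i} (i≤n , q) → subst Q (sym (entry-set i i≤n)) q) facts)))
      , (map-entry-descending (subst (AllPairs _) (sym is≡) (sort-descending (unique (β zero)))) (All.map proj₁ facts)
        , refl , proj₁ rest , proj₁ (proj₂ (proj₂ rest)) , proj₁ (proj₂ (proj₂ (proj₂ rest))))
      , cong₂ _∷_ head-total (proj₂ (proj₂ (proj₂ (proj₂ rest))))
      where
      is = proj₁ (sorted (β zero))
      is≡ = proj₂ (sorted (β zero))
      is↭ : toList is ↭ toList (elements (β zero))
      is↭ = subst (_↭ toList (elements (β zero))) (sym is≡) (sort-↭ _)
      l = List⁺.map entry is
      members : All (_∈f β zero) (toList is)
      members = All-resp-↭ (↭-sym is↭) (All.tabulate id)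
      facts : All (λ i → value i ≤ n × Q (G i)) (toList is)
      facts = All.map (λ {i} m → β≤n zero i m , Qβ zero i m) members
      i₀ = List⁺.head is
      i₀≤n = proj₁ (All.head facts)
      rest = stack (α ∘ suc) (H ∘ suc) (β ∘ suc) (λ i j i<j → β-inc (suc i) (suc j) (s≤s i<j)) (β≤n ∘ suc)
        (top l ⊊_) (let (K , h) = strictly-above (top l ∷ []) in K , All.head h)
        (λ F → ⊊-canonʳ (top l) F)
        λ j i m → subst (_⊊ G i) (sym (entry-set i₀ i₀≤n)) (G-increasing i₀ i
          (≤-trans (s≤s (∈⇒≤max (β zero) (All.head members)))
            (≤-trans (β-inc zero (suc j) (s≤s z≤n)) (∈⇒min≤ (β (suc j)) m)))
          (β≤n (suc j) i m))
      θ : Entry → ℕ⁺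
      θ = term (α zero) (H zero)
      ψ : ℕ⁺ → ℕ⁺
      ψ i = α zero (G i) +⁺ ∑ (H zero (G i)) (f i)
      θ≡ψ : ∀ {i} → value i ≤ n × Q (G i) → value (θ (entry i)) ≡ value (ψ i)
      θ≡ψ {i} (i≤n , _) = cong value (entry-term (α zero) (H zero) i i≤n)
      head-total : total θ l ≡ ∑ (β zero) ψ
      head-total = value-injective (begin
        value (total θ l)                                  ≡⟨ value-total θ l ⟩
        sum (map (value ∘ θ) (map entry (toList is)))      ≡⟨ cong sum (mapₗ-∘ (toList is)) ⟨
        sum (map (value ∘ θ ∘ entry) (toList is))          ≡⟨ cong sum (map-cong-local (All.map θ≡ψ facts)) ⟩
        sum (map (value ∘ ψ) (toList is))                  ≡⟨ sum-↭ (↭-map⁺ (value ∘ ψ) is↭) ⟩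
        sum (map (value ∘ ψ) (toList (elements (β zero)))) ≡⟨ value-∑ (β zero) ψ ⟨
        value (∑ (β zero) ψ)                               ∎)
        where open ≡-Reasoning

  -- (b) bounds only the last βⱼ by n, whereas `stack` takes the bound for all of them.
  increasing≤last : ∀ {k} (β : Fin (suc k) → 𝒫f ℕ⁺) → (∀ i j → i Fin.< j → β i <f β j) →
    ∀ j x → x ∈f β j → value x ≤ max (β (fromℕ k))
  increasing≤last {zero}  β β-inc zero    x m = ∈⇒≤max (β zero) m
  increasing≤last {suc k} β β-inc (suc j) x m = 
    increasing≤last (β ∘ suc) (λ i j i<j → β-inc (suc i) (suc j) (s≤s i<j)) j x m
  increasing≤last {suc k} β β-inc zero    x m = let y = List⁺.head (elements (β (fromℕ (suc k)))) in
    <⇒≤ (≤-trans (s≤s (∈⇒≤max (β zero) m)) (≤-trans (β-inc zero (fromℕ (suc k)) (s≤s z≤n))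
      (≤-trans (∈⇒min≤ {y} (β (fromℕ (suc k))) (hereₗ refl)) (∈⇒≤max (β (fromℕ (suc k))) (hereₗ refl)))))

  idempotents⇒realizes : ∀ {k A} p → (∀ i → 𝒥 (p i) × Idempotent (p i)) → A ∈ sets (⨂ k p) →
    ∃ λ α → ∃ λ H → (∀ i → Respects (α i) (H i)) × Realizes k A α H
  idempotents⇒realizes {k} {A} p hp A∈ with idempotents⇒stacked p hp (λ _ → A) (λ _ → subst T (⨂≡Prod k p A) A∈)
  ... | α , H , respects , stacked∈A = α , H , respects , λ n _ G G-inc β β-inc β≤n f f∈G →
    let (F , ls , _ , stacked , e) = stack n G G-inc f f∈G α H β β-inc
          (λ j x m → ≤-trans (increasing≤last β β-inc j x m) β≤n) (λ _ → ⊤) (fromList⁺ (id ∷⁺ []) , tt) _ _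
    in subst (_∈ A) e (stacked∈A F ls stacked)

theorem1p25 : ExcludedMiddle 0ℓ → Extensionality 0ℓ 0ℓ →
    (k : ℕ) (A : Subset (Vec ℕ⁺ (suc k))) →
    (∃ λ (α : Fin (suc k) → 𝒫f-setoid (ℕ⁺ → ℕ⁺) ⟶ₛ setoid ℕ⁺) →
    ∃ λ (H : Fin (suc k) → 𝒫f-setoid (ℕ⁺ → ℕ⁺) ⟶ₛ 𝒫f-setoid ℕ⁺) →
    ((F G : 𝒫f (ℕ⁺ → ℕ⁺)) → F ⊊ G →
    (i : Fin (suc k)) → max (H i ⟨$⟩ F) < min (H i ⟨$⟩ G))
    ×
    ((n : ℕ) → suc k ≤ n →
    (G : ℕ⁺ → 𝒫f (ℕ⁺ → ℕ⁺)) →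
    (∀ i j → value i < value j → value j ≤ n → G i ⊊ G j) →
    (β : Fin (suc k) → 𝒫f ℕ⁺) →
    (∀ i j → i Fin.< j → β i <f β j) →
    max (β (fromℕ k)) ≤ n →
    (f : ℕ⁺ → ℕ⁺ → ℕ⁺) →
    (∀ i → value i ≤ n → f i ∈f G i) →
    tabulate (λ j → ∑ (β j) (λ i → (α j ⟨$⟩ G i) +⁺ ∑ (H j ⟨$⟩ G i) (f i))) ∈ A))
    ⇔
    (∃ λ (p : Fin (suc k) → Ultrafilter ℕ⁺) →
    ((i : Fin (suc k)) → 𝒥 (p i) × Idempotent (p i))
    × A ∈ sets (⨂ k p))
theorem1p25 em ext k A = mk⇔
  (λ (α , H , _ , realizes) → realizes⇒idempotents {α = λ i → α i ⟨$⟩_} {H = λ i → H i ⟨$⟩_} realizes)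
  λ (p , hp , A∈) →
    let (α , H , respects , realizes) = idempotents⇒realizes {k} {A} p hp A∈ in
    (λ i → record { to = α i ; cong = λ {F} {G} → proj₁ (respects i) F G })
    , (λ i → record { to = H i ; cong = λ {F} {G} F≈G →
        subst (H i F ≈_) (proj₁ (proj₂ (respects i)) F G F≈G) (id , id) })
    , (λ F G F⊊G i → proj₂ (proj₂ (respects i)) F G F⊊G)
    , realizes
  where open Classical em ext
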